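{- Let $f_0(x)=\lceil\log_2 x\rceil$ and let $r$ be a positive integer. There exists a polynomial $P_r$ such that for every finite simple graph $G$, $$N_{f_0}(G,r)\le P_r\big(\widetilde\nabla_{2^r}(G)\big).$$
   Context: For a finite simple graph $G$, a function $f:\mathbb{N}\to\mathbb{N}$ and a positive integer $p$, $N_f(G,p)$ denotes the minimum number of colours in a colouring of the edges of $G$ such that every cycle $\gamma$ of $G$ receives at least $\min(f(|\gamma|),p+1)$ distinct colours, where $|\gamma|$ is the length of $\gamma$. For a half-integer $r\ge 0$, a simple graph $H$ is a shallow topological minor of $G$ at depth $r$ if some $\le 2r$-subdivision of $H$ (each edge replaced by a path with at most $2r$ internal vertices, the paths being internally vertex-disjoint) is a subgraph of $G$; $\widetilde\nabla_r(G)$ is the maximum of $\|H\|/|H|$ over all such simple graphs $H$. -}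

module Defs where

open import Data.Bool.Base using (Bool; true; false; T; _∧_)
open import Data.Bool.Properties using (T?; ∧-comm)
open import Data.Empty using (⊥-elim)
open import Data.Fin.Base using (Fin; zero; suc; toℕ; _<_)
open import Data.Fin.Properties using (_≟_; _<?_; all?; toℕ-fromℕ<; injective⇒≤)
open import Data.Integer.Base using (+_)
open import Data.List.Base using (List; []; _∷_; [_]; _++_; length; lookup; map; filter; foldr; concat; concatMap; tabulate; allFin; upTo; cartesianProduct; cartesianProductWith; deduplicate)
open import Data.List.Membership.Propositional using (_∈_; find; lose)
open import Data.List.Membership.Propositional.Properties using (∈-allFin; ∈-cartesianProductWith⁺; ∈-concatMap⁺; ∈-map⁺; ∈-filter⁺; ∈-upTo⁺)
open import Data.List.Properties using (tabulate-cong; length-tabulate; filter-all)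
open import Data.List.Relation.Unary.All using ([]; _∷_)
import Data.List.Relation.Unary.All as All
import Data.List.Relation.Unary.All.Properties as Allₚ
open import Data.List.Relation.Unary.AllPairs using ([]; _∷_)
open import Data.List.Relation.Unary.Any using (Any; here; there; any?)
open import Data.List.Relation.Unary.Linked using (Linked; linked?)
open import Data.List.Relation.Unary.Unique.Propositional using (Unique)
import Data.List.Relation.Unary.Unique.Propositional.Properties as Uniqueₚ
open import Data.List.Relation.Unary.Unique.DecPropositional using (unique?)
open import Data.Nat.Base as ℕ using (ℕ; zero; suc; _+_; _*_; _≤_; _⊓_; z≤n; s≤s)
open import Data.Nat.DivMod using (_%_; _/_; _mod_; %-distribˡ-+; m≡m%n+[m/n]*n; m%n<n; m<n⇒m%n≡m)
open import Data.Nat.Logarithm using (⌈log₂_⌉; ⌈log₂⌉-mono-≤; ⌈log₂2^n⌉≡n)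
import Data.Nat.Properties as ℕₚ
open import Data.Product.Base using (Σ; ∃; _×_; _,_; proj₁; proj₂)
open import Data.Product.Properties using (≡-dec)
open import Data.Rational.Base as ℚ using (ℚ; 0ℚ)
import Data.Rational.Properties as ℚₚ
open import Data.Sum.Base using (_⊎_; inj₁; inj₂)
open import Data.Vec.Base as Vec using (Vec; []; _∷_)
import Data.Vec.Properties as Vecₚ
open import Function.Base using (_∘_; id)
open import Function.Definitions using (Injective)
open import Relation.Binary.Bundles using (DecTotalOrder)
open import Relation.Binary.PropositionalEquality using (_≡_; refl; sym; trans; cong; cong₂; subst; _≗_)
open import Relation.Nullary using (¬_; Dec; yes; no; does)
open import Relation.Nullary.Decidable using (map′; _×-dec_; _→-dec_; _⊎-dec_; ¬?; decidable-stable)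
open import Relation.Unary using (Decidable)

record Graph : Set where
  field
    order  : ℕ
    adj    : Fin order → Fin order → Bool
    adjSym : ∀ u v → adj u v ≡ adj v u
    irrefl : ∀ v → adj v v ≡ false

  Vertex : Set
  Vertex = Fin order

  _~_ : Vertex → Vertex → Set
  u ~ v = T (adj u v)

open Graph using (order; Vertex)

edge? : ∀ {n} (adj : Fin n → Fin n → Bool) → Decidable {A = Fin n × Fin n} (λ (u , v) → u < v × T (adj u v))
edge? adj (u , v) = (u <? v) ×-dec T? (adj u v)

-- Each unordered edge is listed once, as the pair (u , v) with u < v.
edgeList : ∀ {n} → (Fin n → Fin n → Bool) → List (Fin n × Fin n)
edgeList {n} adj = filter (edge? adj) (cartesianProduct (allFin n) (allFin n))

edges : (G : Graph) → List (Vertex G × Vertex G)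
edges G = edgeList (Graph.adj G)

size : Graph → ℕ
size G = length (edges G)

Edge : Graph → Set
Edge G = Fin (size G)

Joins : (G : Graph) → Edge G → Vertex G → Vertex G → Set
Joins G e u v = lookup (edges G) e ≡ (u , v) ⊎ lookup (edges G) e ≡ (v , u)

record Cycle (G : Graph) : Set where
  field
    len-3 : ℕ

  len : ℕ
  len = 3 + len-3

  field
    vertex    : Fin len → Vertex G
    edge      : Fin len → Edge G
    vertexInj : Injective _≡_ _≡_ vertex
    joins     : ∀ i → Joins G (edge i) (vertex i) (vertex (suc (toℕ i) mod len))

Colouring : Graph → ℕ → Set
Colouring G k = Edge G → Fin k

numColours : ∀ {G k} → Colouring G k → Cycle G → ℕ
numColours c γ = length (deduplicate _≟_ (tabulate (c ∘ Cycle.edge γ)))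

IsGood : (f : ℕ → ℕ) (G : Graph) (p : ℕ) {k : ℕ} → Colouring G k → Set
IsGood f G p c = ∀ γ → f (Cycle.len γ) ⊓ (p + 1) ≤ numColours {G} c γ

IsMinColours : (f : ℕ → ℕ) (G : Graph) (p : ℕ) → ℕ → Set
IsMinColours f G p k =
  (Σ (Colouring G k) (IsGood f G p)) ×
  (∀ j → Σ (Colouring G j) (IsGood f G p) → k ≤ j)

-- A (≤ s)-subdivision of H inside G.  The list `path e` holds the internal
-- vertices, in order, of the path replacing the edge e.
record ShallowTopMinor (s : ℕ) (H G : Graph) : Set where
  field
    branch : Vertex H → Vertex G
    path   : Edge H → List (Vertex G)
    short  : ∀ e → length (path e) ≤ s
    walk   : ∀ e → let (u , v) = lookup (edges H) e in
             Linked (Graph._~_ G) (branch u ∷ path e ++ [ branch v ])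
    unique : Unique (tabulate branch ++ concat (tabulate path))

-- The null graph gets density 0; any graph with a vertex has the one-vertex
-- graph, also of density 0, as a shallow topological minor.
ratio : ℕ → ℕ → ℚ
ratio m zero    = 0ℚ
ratio m (suc n) = + m ℚ./ suc n

density : Graph → ℚ
density H = ratio (size H) (order H)

IsMaxDensity : (s : ℕ) (G : Graph) → ℚ → Set
IsMaxDensity s G q =
  (∃ λ H → ShallowTopMinor s H G × density H ≡ q) ×
  (∀ H → ShallowTopMinor s H G → density H ℚ.≤ q)

private
  variable
    A : Set
    k m n : ℕ

  vecs : List A → (n : ℕ) → List (Vec A n)
  vecs xs zero    = [ [] ]
  vecs xs (suc n) = cartesianProductWith _∷_ xs (vecs xs n)

  ∈-vecs : ∀ {xs : List A} {f : Fin n → A} → (∀ i → f i ∈ xs) → Vec.tabulate f ∈ vecs xs n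
  ∈-vecs {n = zero}  p = here refl
  ∈-vecs {n = suc n} p = ∈-cartesianProductWith⁺ _∷_ (p zero) (∈-vecs (p ∘ suc))

  lists : List A → ℕ → List (List A)
  lists xs zero    = [ [] ]
  lists xs (suc s) = [] ∷ cartesianProductWith _∷_ xs (lists xs s)

  ∈-lists : ∀ {xs : List A} → (∀ a → a ∈ xs) → ∀ s ys → length ys ≤ s → ys ∈ lists xs s
  ∈-lists p zero    []       _       = here refl
  ∈-lists p (suc s) []       _       = here refl
  ∈-lists p (suc s) (y ∷ ys) (s≤s l) = there (∈-cartesianProductWith⁺ _∷_ (p y) (∈-lists p s ys l))

  ∃fun? : {P : (Fin n → A) → Set} (xs : List A) → (∀ {f} → P f → ∀ i → f i ∈ xs) →
          (∀ {f g} → f ≗ g → P f → P g) → Decidable P → Dec (∃ P)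
  ∃fun? {n = n} {P = P} xs bound resp P? = map′ to from (any? (P? ∘ Vec.lookup) (vecs xs n))
    where
    to : Any (P ∘ Vec.lookup) (vecs xs n) → ∃ P
    to a with find a
    ... | v , _ , pv = Vec.lookup v , pv
    from : ∃ P → Any (P ∘ Vec.lookup) (vecs xs n)
    from (f , pf) = lose (∈-vecs (bound pf)) (resp (sym ∘ Vecₚ.lookup∘tabulate f) pf)

  joins? : ∀ G e u v → Dec (Joins G e u v)
  joins? G e u v = ≡-dec _≟_ _≟_ _ _ ⊎-dec ≡-dec _≟_ _≟_ _ _

  injective? : (f : Fin m → Fin n) → Dec (Injective _≡_ _≡_ f)
  injective? f = map′ (λ h {i} {j} → h i j) (λ h i j → h)
    (all? λ i → all? λ j → (f i ≟ f j) →-dec (i ≟ j))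

  module _ (f : ℕ → ℕ) (G : Graph) (p : ℕ) where

    Bad : ∀ {k} → Colouring G k → (l : ℕ) → (Fin (3 + l) → Vertex G) → (Fin (3 + l) → Edge G) → Set
    Bad c l vs es =
      Injective _≡_ _≡_ vs ×
      (∀ i → Joins G (es i) (vs i) (vs (suc (toℕ i) mod (3 + l)))) ×
      ¬ (f (3 + l) ⊓ (p + 1) ≤ length (deduplicate _≟_ (tabulate (c ∘ es))))

    good? : ∀ {k} (c : Colouring G k) → Dec (IsGood f G p c)
    good? {k} c with any? (λ l →
        ∃fun? {P = λ vs → ∃ (Bad c l vs)} (allFin _) (λ _ _ → ∈-allFin _) respV λ vs →
        ∃fun? (allFin _) (λ _ _ → ∈-allFin _) (respE {vs = vs}) (bad? l vs)) (upTo (order G))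
      where
      respE : ∀ {l vs es es′} → es ≗ es′ → Bad c l vs es → Bad c l vs es′
      respE {l} {vs} eq (inj , js , b) =
        inj ,
        (λ i → subst (λ e → Joins G e _ _) (eq i) (js i)) ,
        subst (λ cs → ¬ (f (3 + l) ⊓ (p + 1) ≤ length (deduplicate _≟_ cs))) (tabulate-cong (cong c ∘ eq)) b
      respV : ∀ {l vs vs′} → vs ≗ vs′ → ∃ (Bad c l vs) → ∃ (Bad c l vs′)
      respV {l} {vs} {vs′} eq (es , inj , js , b) =
        es ,
        (λ {i} {j} q → inj (trans (eq i) (trans q (sym (eq j))))) ,
        (λ i → subst (λ v → Joins G (es i) v (vs′ (suc (toℕ i) mod (3 + l)))) (eq i)
               (subst (Joins G (es i) (vs i)) (eq (suc (toℕ i) mod (3 + l))) (js i))) ,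
        b
      bad? : ∀ l vs es → Dec (Bad c l vs es)
      bad? l vs es = injective? vs ×-dec all? (λ i → joins? G _ _ _) ×-dec ¬? (_ ℕₚ.≤? _)
    ... | yes a with find a
    ...   | l , _ , vs , es , inj , js , b =
      no λ g → b (g (record { len-3 = l ; vertex = vs ; edge = es ; vertexInj = inj ; joins = js }))
    good? {k} c | no ¬a = yes λ γ → let open Cycle γ in
      decidable-stable (_ ℕₚ.≤? _) λ b →
        ¬a (lose (∈-upTo⁺ (ℕₚ.≤-trans (ℕₚ.m≤n+m (1 + len-3) 2) (injective⇒≤ vertexInj)))
                 (vertex , edge , vertexInj , joins , b))

    colourable? : ∀ k → Dec (Σ (Colouring G k) (IsGood f G p))
    colourable? k = ∃fun? (allFin k) (λ _ _ → ∈-allFin _)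
      (λ eq g γ → subst (λ cs → f (Cycle.len γ) ⊓ (p + 1) ≤ length (deduplicate _≟_ cs)) (tabulate-cong (eq ∘ Cycle.edge γ)) (g γ))
      good?

  next≢prev : ∀ l {i j : Fin (3 + l)} → i ≡ suc (toℕ j) mod (3 + l) → ¬ (suc (toℕ i) mod (3 + l) ≡ j)
  next≢prev l {i} {j} refl eq = absurd (N / L) (ℕₚ.+-cancelʳ-≡ (toℕ j) 2 (N / L * L) (trans (m≡m%n+[m/n]*n N L) (trans (cong (_+ N / L * L) N%L) (ℕₚ.+-comm (toℕ j) _))))
    where
    L = 3 + l
    N = 2 + toℕ j
    toℕ-mod : ∀ a → toℕ (a mod L) ≡ a % L
    toℕ-mod a = toℕ-fromℕ< (m%n<n a L)
    N%L : N % L ≡ toℕ j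
    N%L = trans (%-distribˡ-+ 1 (1 + toℕ j) L)
         (trans (cong (λ x → (x + (1 + toℕ j) % L) % L) (m<n⇒m%n≡m {n = L} {m = 1} (s≤s (s≤s z≤n))))
         (trans (cong (λ x → suc x % L) (sym (toℕ-mod (1 + toℕ j))))
         (trans (sym (toℕ-mod (suc (toℕ (suc (toℕ j) mod L))))) (cong toℕ eq))))
    absurd : ∀ q → ¬ (2 ≡ q * L)
    absurd zero    ()
    absurd (suc q) ()

  edgeInj : ∀ {G} (γ : Cycle G) → Injective _≡_ _≡_ (Cycle.edge γ)
  edgeInj {G} γ {i} {j} eq = go (joins i) (subst (λ e → Joins G e _ _) (sym eq) (joins j))
    where
    open Cycle γ
    cross : ∀ {x} → x ≡ (vertex i , vertex (suc (toℕ i) mod len)) →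
            x ≡ (vertex (suc (toℕ j) mod len) , vertex j) → i ≡ j
    cross p q = ⊥-elim (next≢prev len-3 (vertexInj (cong proj₁ (trans (sym p) q))) (vertexInj (cong proj₂ (trans (sym p) q))))
    go : Joins G (edge i) (vertex i) _ → Joins G (edge i) (vertex j) _ → i ≡ j
    go (inj₁ p) (inj₁ q) = vertexInj (cong proj₁ (trans (sym p) q))
    go (inj₂ p) (inj₂ q) = vertexInj (cong proj₂ (trans (sym p) q))
    go (inj₁ p) (inj₂ q) = cross p q
    go (inj₂ p) (inj₁ q) = cross (cong (λ (a , b) → b , a) p) (cong (λ (a , b) → b , a) q)

  deduplicate-unique : {xs : List (Fin k)} → Unique xs → deduplicate _≟_ xs ≡ xs
  deduplicate-unique [] = refl
  deduplicate-unique {xs = x ∷ xs} (x∉ ∷ u) rewrite deduplicate-unique u =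
    cong (x ∷_) (filter-all _ x∉)

  rainbow : ∀ {f} → (∀ x → f x ≤ x) → ∀ G p → IsGood f G p {size G} id
  rainbow {f} f≤ G p γ = ℕₚ.≤-trans (ℕₚ.m⊓n≤m _ _) (ℕₚ.≤-trans (f≤ len) (ℕₚ.≤-reflexive (sym
    (trans (cong length (deduplicate-unique (Uniqueₚ.tabulate⁺ (edgeInj γ)))) (length-tabulate edge)))))
    where open Cycle γ

  least : {P : ℕ → Set} → Decidable P → ∀ n → P n → ∃ λ k → P k × (∀ j → P j → k ≤ j)
  least P? n pn with P? 0
  ... | yes p0 = 0 , p0 , λ _ _ → z≤n
  least P? zero pn | no ¬p0 = ⊥-elim (¬p0 pn)
  least P? (suc n) pn | no ¬p0 with least (P? ∘ suc) n pn
  ... | k , pk , min = suc k , pk , λ { zero p0 → ⊥-elim (¬p0 p0) ; (suc j) pj → s≤s (min j pj) }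

  filter-cong : {P Q : A → Set} (P? : Decidable P) (Q? : Decidable Q) →
                (∀ x → does (P? x) ≡ does (Q? x)) → filter P? ≗ filter Q?
  filter-cong P? Q? eq []       = refl
  filter-cong P? Q? eq (x ∷ xs) with does (P? x) | does (Q? x) | eq x
  ... | true  | true  | refl = cong (x ∷_) (filter-cong P? Q? eq xs)
  ... | false | false | refl = filter-cong P? Q? eq xs

  edgeList-cong : (a b : Fin n → Fin n → Bool) → (∀ u v → a u v ≡ b u v) → edgeList a ≡ edgeList b
  edgeList-cong a b eq = filter-cong (edge? a) (edge? b)
    (λ (u , v) → cong (λ t → does ((u <? v) ×-dec T? t)) (eq u v))
    (cartesianProduct (allFin _) (allFin _))

  module _ (s : ℕ) (G : Graph) where

    Paths : (es : List (Fin n × Fin n)) (branch : Fin n → Vertex G) (path : Fin (length es) → List (Vertex G)) → Set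
    Paths es branch path =
      (∀ e → length (path e) ≤ s) ×
      (∀ e → let (u , v) = lookup es e in Linked (Graph._~_ G) (branch u ∷ path e ++ [ branch v ])) ×
      Unique (tabulate branch ++ concat (tabulate path))

    Model : List (Fin n × Fin n) → Set
    Model es = ∃ λ branch → ∃ (Paths es branch)

    paths? : (es : List (Fin n × Fin n)) → ∀ b p → Dec (Paths es b p)
    paths? es b p = all? (λ e → _ ℕₚ.≤? _) ×-dec
                    all? (λ e → linked? (λ _ _ → T? _) _) ×-dec
                    unique? _≟_ _

    model? : (es : List (Fin n × Fin n)) → Dec (Model es)
    model? {n} es = ∃fun? (allFin _) (λ _ _ → ∈-allFin _) respB
      λ b → ∃fun? (lists (allFin _) s) (λ (sh , _) i → ∈-lists ∈-allFin s _ (sh i)) (respP b) (paths? es b)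
      where
      respP : ∀ b {p q} → p ≗ q → Paths es b p → Paths es b q
      respP b eq (sh , w , u) =
        (λ e → subst (λ l → length l ≤ s) (eq e) (sh e)) ,
        (λ e → subst (λ l → Linked (Graph._~_ G) (b _ ∷ l ++ _)) (eq e) (w e)) ,
        subst (λ l → Unique (tabulate b ++ concat l)) (tabulate-cong eq) u
      respB : ∀ {b c} → b ≗ c → ∃ (Paths es b) → ∃ (Paths es c)
      respB {b} {c} eq (p , sh , w , u) = p , sh ,
        (λ e → let (x , y) = lookup es e in
          subst (λ z → Linked (Graph._~_ G) (z ∷ p e ++ [ c y ])) (eq x)
          (subst (λ z → Linked (Graph._~_ G) (b x ∷ p e ++ [ z ])) (eq y) (w e))) ,
        subst (λ l → Unique (l ++ concat (tabulate p))) (tabulate-cong eq) u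

    toModel : ∀ {H} → ShallowTopMinor s H G → Model (edges H)
    toModel t = branch , path , short , walk , unique where open ShallowTopMinor t

    fromModel : ∀ {H} → Model (edges H) → ShallowTopMinor s H G
    fromModel (b , p , sh , w , u) = record { branch = b ; path = p ; short = sh ; walk = w ; unique = u }

    order≤ : ∀ {H} → ShallowTopMinor s H G → order H ≤ order G
    order≤ {H} t = injective⇒≤ {f = branch} (inj branch (Uniqueₚ-++ˡ (tabulate branch) unique))
      where
      open ShallowTopMinor t
      Uniqueₚ-++ˡ : ∀ {A : Set} (xs : List A) {ys} → Unique (xs ++ ys) → Unique xs
      Uniqueₚ-++ˡ []       u        = []
      Uniqueₚ-++ˡ (x ∷ xs) (x∉ ∷ u) = Allₚ.++⁻ˡ xs x∉ ∷ Uniqueₚ-++ˡ xs u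
      inj : ∀ {n} {B : Set} (g : Fin n → B) → Unique (tabulate g) → Injective _≡_ _≡_ g
      inj g u        {zero}  {zero}  eq = refl
      inj g (x ∷ u)  {zero}  {suc j} eq = ⊥-elim (Allₚ.tabulate⁻ x j eq)
      inj g (x ∷ u)  {suc i} {zero}  eq = ⊥-elim (Allₚ.tabulate⁻ x i (sym eq))
      inj g (x ∷ u)  {suc i} {suc j} eq = cong suc (inj (g ∘ suc) u eq)

  entry : Vec (Vec Bool n) n → Fin n → Fin n → Bool
  entry M u v = Vec.lookup (Vec.lookup M u) v

  symAdj : Vec (Vec Bool n) n → Fin n → Fin n → Bool
  symAdj M u v with u ≟ v
  ... | yes _ = false
  ... | no  _ = entry M u v ∧ entry M v u

  fromMatrix : Vec (Vec Bool n) n → Graph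
  fromMatrix {n} M = record { order = n ; adj = symAdj M ; adjSym = s ; irrefl = i }
    where
    s : ∀ u v → symAdj M u v ≡ symAdj M v u
    s u v with u ≟ v | v ≟ u
    ... | yes _  | yes _  = refl
    ... | yes eq | no ¬eq = ⊥-elim (¬eq (sym eq))
    ... | no ¬eq | yes eq = ⊥-elim (¬eq (sym eq))
    ... | no _   | no _   = ∧-comm (entry M u v) (entry M v u)
    i : ∀ v → symAdj M v v ≡ false
    i v with v ≟ v
    ... | yes _  = refl
    ... | no ¬eq = ⊥-elim (¬eq refl)

  matrix : (H : Graph) → Vec (Vec Bool (order H)) (order H)
  matrix H = Vec.tabulate λ u → Vec.tabulate (Graph.adj H u)

  edges-matrix : ∀ H → edges (fromMatrix (matrix H)) ≡ edges H
  edges-matrix H = edgeList-cong (symAdj (matrix H)) adj eq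
    where
    open Graph H using (adj; adjSym; irrefl)
    e : ∀ u v → entry (matrix H) u v ≡ adj u v
    e u v = trans (cong (λ r → Vec.lookup r v) (Vecₚ.lookup∘tabulate _ u)) (Vecₚ.lookup∘tabulate _ v)
    idem : ∀ b → b ∧ b ≡ b
    idem true  = refl
    idem false = refl
    eq : ∀ u v → symAdj (matrix H) u v ≡ adj u v
    eq u v with u ≟ v
    ... | yes refl = sym (irrefl u)
    ... | no _     = trans (cong₂ _∧_ (e u v) (trans (e v u) (adjSym v u))) (idem _)

  graphsOf : ℕ → List Graph
  graphsOf n = map fromMatrix (vecs (vecs (true ∷ false ∷ []) n) n)

  graphs : ℕ → List Graph
  graphs N = concatMap graphsOf (upTo (suc N))

  ∈-graphs : ∀ {N} H → order H ≤ N → fromMatrix (matrix H) ∈ graphs N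
  ∈-graphs H le = ∈-concatMap⁺ graphsOf (lose (∈-upTo⁺ (s≤s le))
    (∈-map⁺ fromMatrix (∈-vecs λ u → ∈-vecs λ v → bool (Graph.adj H u v))))
    where
    bool : ∀ b → b ∈ true ∷ false ∷ []
    bool true  = here refl
    bool false = there (here refl)

  null : Graph
  null = record { order = 0 ; adj = λ () ; adjSym = λ () ; irrefl = λ () }

  null-minor : ∀ s G → ShallowTopMinor s null G
  null-minor s G = record { branch = λ () ; path = λ () ; short = λ () ; walk = λ () ; unique = [] }

abstract

  -- Without a bound on f a good colouring may fail to exist.
  minColours : (f : ℕ → ℕ) → (∀ x → f x ≤ x) → (G : Graph) (p : ℕ) → ∃ (IsMinColours f G p)
  minColours f f≤ G p = least (colourable? f G p) (size G) (id , rainbow f≤ G p)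

  maxDensity : (s : ℕ) (G : Graph) → ∃ (IsMaxDensity s G)
  maxDensity s G = density H* , (H* , minor , refl) , upper
    where
    open import Data.List.Extrema (DecTotalOrder.totalOrder ℚₚ.≤-decTotalOrder) using (argmax; argmax-all; f[xs]≤f[argmax])
    minor? : ∀ H → Dec (ShallowTopMinor s H G)
    minor? H = map′ (fromModel s G) (toModel s G) (model? s G (edges H))
    candidates : List Graph
    candidates = filter minor? (graphs (order G))
    H* : Graph
    H* = argmax density null candidates
    minor : ShallowTopMinor s H* G
    minor = argmax-all density {P = λ H → ShallowTopMinor s H G} (null-minor s G) (Allₚ.all-filter minor? (graphs (order G)))
    upper : ∀ H → ShallowTopMinor s H G → density H ℚ.≤ density H*
    upper H t = subst (ℚ._≤ density H*) (cong (λ es → ratio (length es) (order H)) (edges-matrix H))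
      (All.lookup (f[xs]≤f[argmax] {f = density} null candidates)
        (∈-filter⁺ minor? (∈-graphs H (order≤ s G t))
          (fromModel s G {H′} (subst (Model s G) (sym (edges-matrix H)) (toModel s G t)))))
      where
      H′ : Graph
      H′ = fromMatrix (matrix H)

N : (f : ℕ → ℕ) → (∀ x → f x ≤ x) → Graph → ℕ → ℕ
N f f≤ G p = proj₁ (minColours f f≤ G p)

-- The half-integer depth r is passed as s = 2r.
∇̃ : (s : ℕ) → Graph → ℚ
∇̃ s G = proj₁ (maxDensity s G)

f₀ : ℕ → ℕ
f₀ x = ⌈log₂ x ⌉

f₀≤id : ∀ x → f₀ x ≤ x
f₀≤id x = ℕₚ.≤-trans (⌈log₂⌉-mono-≤ (x≤2^x x)) (ℕₚ.≤-reflexive (⌈log₂2^n⌉≡n x))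
  where
  x≤2^x : ∀ x → x ≤ 2 ℕ.^ x
  x≤2^x zero    = z≤n
  x≤2^x (suc x) = ℕₚ.+-mono-≤ (ℕₚ.m^n>0 2 x) (ℕₚ.≤-trans (x≤2^x x) (ℕₚ.m≤m+n _ 0))

-- Coefficient lists, constant term first.
Polynomial : Set
Polynomial = List ℚ

eval : Polynomial → ℚ → ℚ
eval P x = foldr (λ a y → a ℚ.+ x ℚ.* y) 0ℚ P

{-# OPTIONS --safe #-}

-- Fraternal augmentation: orient G with bounded indegree and, for increasing weight w, join the
-- tails of any two arcs of total weight w with a common head, again orienting the new edges
-- with bounded indegree. This works because an edge of weight w stands for a walk of length w
-- in G and every vertex lies on boundedly many of these walks; two auxiliary colourings split
-- the walks into a bounded number of shallow topological minors, so the new edges are sparse.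
-- All bounds are polynomial in the density.
--
-- Colour the vertices so that each differs from its ancestors at bounded distance in the augmented
-- digraph. On a short path, bypassing internal sinks shows that any two vertices have a common
-- ancestor on the path, hence some vertex of the path is an ancestor of all others and its colour
-- occurs once. Colour an edge by the colours of its ends: deleting that vertex and halving shows
-- that a path on 2^m vertices sees m edge colours, and a cycle of length > 2^m sees m + 1.

module Submission where

open import Defs
open import Data.Bool.Base using (Bool; T)
open import Data.Bool.Properties using (T?)
open import Data.Empty using (⊥-elim)
open import Data.Fin.Base as Fin using (Fin; zero; suc; toℕ; combine)
import Data.Fin.Properties as Finₚ
import Data.Integer.Base as ℤ
import Data.Integer.Properties as ℤₚ
open import Data.List.Base using (List; []; _∷_; [_]; _++_; length; lookup; map; filter; concat; concatMap; tabulate; allFin; cartesianProduct; reverse; initLast; _∷ʳ′_)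
open import Data.List.Membership.Propositional using (_∈_; _∉_; find; lose)
open import Data.List.Membership.Propositional.Properties
open import Data.List.Properties as Listₚ using (length-map; length-++; length-reverse; unfold-reverse; length-tabulate; filter-notAll; length-filter; ++-assoc)
open import Data.List.Relation.Unary.All as All using (All; []; _∷_)
import Data.List.Relation.Unary.All.Properties as Allₚ
open import Data.List.Relation.Unary.AllPairs as AllPairs using (AllPairs; []; _∷_)
import Data.List.Relation.Unary.AllPairs.Properties as AllPairsₚ
open import Data.List.Relation.Unary.Any as Any using (Any; here; there; any?)
import Data.List.Relation.Unary.Any.Properties as Anyₚ
open import Data.List.Relation.Unary.Linked using (Linked; [-]; _∷_)
open import Data.List.Relation.Unary.Unique.Propositional using (Unique)
import Data.List.Relation.Unary.Unique.Propositional.Properties as Uniqueₚ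
open import Data.Nat.Base using (ℕ; zero; suc; _+_; _*_; _^_; _≤_; _<_; z≤n; s≤s; _≤′_; ≤′-reflexive; ≤′-step)
open import Data.Nat.DivMod using (_%_; _/_; _mod_; %-distribˡ-+; m%n%n≡m%n; m≡m%n+[m/n]*n; m%n<n; m/n*n≤m)
open import Data.Nat.Divisibility using (divides; ∣m+n∣m⇒∣n; ∣⇒≤)
open import Data.Nat.ListAction using (sum)
open import Data.Nat.Logarithm using (⌈log₂_⌉; ⌈log₂⌉-mono-≤; ⌈log₂2^n⌉≡n)
import Data.Nat.Properties as ℕₚ
open import Algebra.Properties.CommutativeSemigroup ℕₚ.+-commutativeSemigroup using (x∙yz≈y∙xz)
open import Data.Product.Base using (∃; ∃₂; _×_; _,_; proj₁; proj₂)
open import Data.Product.Properties using (≡-dec)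
import Data.Rational.Base as ℚ
import Data.Rational.Properties as ℚₚ
open import Data.Rational.Solver using (module +-*-Solver)
open import Data.Rational.Unnormalised.Base as ℚᵘ using (mkℚᵘ)
import Data.Rational.Unnormalised.Properties as ℚᵘₚ
open import Data.Sum.Base using (_⊎_; inj₁; inj₂; swap)
open import Function.Base using (_∘_; id; case_of_)
open import Function.Bundles using (mk⇔)
open import Function.Definitions using (Injective)
open import Relation.Binary.Definitions using (DecidableEquality; tri<; tri≈; tri>)
open import Relation.Binary.PropositionalEquality using (_≡_; _≢_; refl; sym; trans; cong; cong₂; subst; subst₂; ≢-sym)
open import Relation.Nullary using (¬_; Dec; yes; no; does)
open import Relation.Nullary.Decidable using (_×-dec_; _⊎-dec_; ¬?; does-⇔; dec-false; toWitness; fromWitness; isYes≗does)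

-- Counting and degeneracy

∈-lookup⇒index : ∀ {A : Set} {x : A} {xs} (x∈ : x ∈ xs) → x ≡ lookup xs (Any.index x∈)
∈-lookup⇒index (here refl) = refl
∈-lookup⇒index (there x∈) = ∈-lookup⇒index x∈

lookup-injective : ∀ {A : Set} {xs : List A} → Unique xs → Injective _≡_ _≡_ (lookup xs)
lookup-injective (x∉ ∷ u) {zero}  {zero}  eq = refl
lookup-injective (x∉ ∷ u) {zero}  {suc j} eq = ⊥-elim (All.lookup x∉ (∈-lookup j) eq)
lookup-injective (x∉ ∷ u) {suc i} {zero}  eq = ⊥-elim (All.lookup x∉ (∈-lookup i) (sym eq))
lookup-injective (x∉ ∷ u) {suc i} {suc j} eq = cong suc (lookup-injective u eq)

unique-⊆⇒length≤ : ∀ {A : Set} {xs ys : List A} → Unique xs → (∀ {x} → x ∈ xs → x ∈ ys) → length xs ≤ length ys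
unique-⊆⇒length≤ {xs = xs} {ys} u sub = Finₚ.injective⇒≤ {f = λ i → Any.index (sub (∈-lookup {xs = xs} i))} λ {i} {j} eq →
  lookup-injective u (trans (∈-lookup⇒index (sub (∈-lookup i))) (trans (cong (lookup ys) eq) (sym (∈-lookup⇒index (sub (∈-lookup j))))))

length-concatMap≤ : ∀ {A B : Set} (f : A → List B) {k} xs → (∀ {x} → x ∈ xs → length (f x) ≤ k) → length (concatMap f xs) ≤ length xs * k
length-concatMap≤ f []       h = z≤n
length-concatMap≤ f (x ∷ xs) h = ℕₚ.≤-trans (ℕₚ.≤-reflexive (length-++ (f x)))
  (ℕₚ.+-mono-≤ (h (here refl)) (length-concatMap≤ f xs (h ∘ there)))

length-cartesianProduct : ∀ {A B : Set} (xs : List A) (ys : List B) → length (cartesianProduct xs ys) ≡ length xs * length ys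
length-cartesianProduct []       ys = refl
length-cartesianProduct (x ∷ xs) ys = trans (length-++ (map (x ,_) ys)) (cong₂ _+_ (length-map (x ,_) ys) (length-cartesianProduct xs ys))

fresh : ∀ {n} (xs : List (Fin (suc n))) → length xs ≤ n → ∃ λ i → i ∉ xs
fresh {n} xs le with Finₚ.any? (λ i → ¬? (any? (i Finₚ.≟_) xs))
... | yes found = found
... | no none = ⊥-elim (ℕₚ.<⇒≱ (s≤s le) (subst (_≤ length xs) (length-tabulate id)
        (unique-⊆⇒length≤ (Uniqueₚ.allFin⁺ (suc n)) λ {i} _ → stable i)))
  where
  stable : ∀ i → i ∈ xs
  stable i with any? (i Finₚ.≟_) xs
  ... | yes i∈ = i∈
  ... | no i∉ = ⊥-elim (none (i , i∉))

module DoubleCounting {X Y : Set} {R : X → Y → Set} (R? : ∀ x y → Dec (R x y)) where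

  degree : List Y → X → ℕ
  degree ys x = length (filter (R? x) ys)

  codegree : List X → Y → ℕ
  codegree xs y = length (filter (λ x → R? x y) xs)

  total : List X → List Y → ℕ
  total xs ys = sum (map (degree ys) xs)

  total-[] : ∀ xs → total xs [] ≡ 0
  total-[] []       = refl
  total-[] (x ∷ xs) = total-[] xs

  total-∷ : ∀ xs y ys → total xs (y ∷ ys) ≡ codegree xs y + total xs ys
  total-∷ [] y ys = refl
  total-∷ (x ∷ xs) y ys with R? x y
  ... | yes _ = cong suc (trans (cong (degree ys x +_) (total-∷ xs y ys)) (x∙yz≈y∙xz (degree ys x) (codegree xs y) (total xs ys)))
  ... | no _  = trans (cong (degree ys x +_) (total-∷ xs y ys)) (x∙yz≈y∙xz (degree ys x) (codegree xs y) (total xs ys))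

  total≤ : ∀ {k} xs ys → (∀ {y} → y ∈ ys → codegree xs y ≤ k) → total xs ys ≤ length ys * k
  total≤ xs []       h = ℕₚ.≤-reflexive (total-[] xs)
  total≤ xs (y ∷ ys) h = subst (_≤ _) (sym (total-∷ xs y ys)) (ℕₚ.+-mono-≤ (h (here refl)) (total≤ xs ys (h ∘ there)))

  ≤total : ∀ {k} xs ys → (∀ {y} → y ∈ ys → k ≤ codegree xs y) → length ys * k ≤ total xs ys
  ≤total xs []       h = z≤n
  ≤total xs (y ∷ ys) h = subst (_ ≤_) (sym (total-∷ xs y ys)) (ℕₚ.+-mono-≤ (h (here refl)) (≤total xs ys (h ∘ there)))

  sum-degree≤ : ∀ {m} xs ys → (∀ {x} → x ∈ xs → degree ys x ≤ m) → total xs ys ≤ length xs * m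
  sum-degree≤ []       ys h = z≤n
  sum-degree≤ (x ∷ xs) ys h = ℕₚ.+-mono-≤ (h (here refl)) (sum-degree≤ xs ys (h ∘ there))

  ≤sum-degree : ∀ {m} xs ys → (∀ {x} → x ∈ xs → m ≤ degree ys x) → length xs * m ≤ total xs ys
  ≤sum-degree []       ys h = z≤n
  ≤sum-degree (x ∷ xs) ys h = ℕₚ.+-mono-≤ (h (here refl)) (≤sum-degree xs ys (h ∘ there))

  -- Averaging: if every degree were at least `m + 1`, the number of related pairs would exceed
  -- `length (x ∷ xs) * m`, while the codegrees bound it by `length ys * k`.
  ∃-low-degree : ∀ {k m} x xs ys → (∀ {y} → y ∈ ys → codegree (x ∷ xs) y ≤ k) →
                 length ys * k ≤ length (x ∷ xs) * m → ∃ λ a → a ∈ x ∷ xs × degree ys a ≤ m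
  ∃-low-degree {k} {m} x xs ys h le with any? (λ a → degree ys a ℕₚ.≤? m) (x ∷ xs)
  ... | yes a = find a
  ... | no none = ⊥-elim (ℕₚ.<⇒≱ (ℕₚ.*-monoʳ-< (length (x ∷ xs)) {m} {suc m} (ℕₚ.n<1+n m))
    (ℕₚ.≤-trans (≤sum-degree (x ∷ xs) ys (λ a∈ → ℕₚ.≰⇒> λ l → none (lose a∈ l)))
    (ℕₚ.≤-trans (total≤ (x ∷ xs) ys h) le)))

-- Double counting of the pairs with `f y ≡ x`: every `y` lies in at least one of them and every `x`
-- in at most `m`.
pigeonhole : ∀ {X Y : Set} (_≟_ : DecidableEquality X) (f : Y → X) (xs : List X) (ys : List Y) {m} →
             (∀ {y} → y ∈ ys → f y ∈ xs) →
             (∀ x → length (filter (λ y → f y ≟ x) ys) ≤ m) → length ys ≤ length xs * m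
pigeonhole _≟_ f xs ys f∈ h = ℕₚ.≤-trans (ℕₚ.≤-reflexive (sym (ℕₚ.*-identityʳ (length ys))))
  (ℕₚ.≤-trans (≤total xs ys λ {y} y∈ → positive (∈-filter⁺ (f y ≟_) (f∈ y∈) refl))
              (sum-degree≤ xs ys λ {x} _ → h x))
  where
  open DoubleCounting (λ x y → f y ≟ x)
  positive : ∀ {A : Set} {a : A} {as} → a ∈ as → 1 ≤ length as
  positive (here _)  = s≤s z≤n
  positive (there _) = s≤s z≤n

-- Greedy colouring and orientation of degenerate graphs

module Peeling {X : Set} (_≟_ : DecidableEquality X) where

  remove : X → List X → List X
  remove a = filter (λ x → ¬? (x ≟ a))

  length-remove< : ∀ {a} xs → a ∈ xs → length (remove a xs) < length xs
  length-remove< {a} xs a∈ = filter-notAll (λ x → ¬? (x ≟ a)) xs (lose a∈ (λ ¬p → ¬p refl))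

  ∈-remove : ∀ {a x xs} → x ∈ xs → x ≢ a → x ∈ remove a xs
  ∈-remove {a} = ∈-filter⁺ (λ x → ¬? (x ≟ a))

  open import Data.List.Membership.DecPropositional _≟_ using (_∈?_)

  module _ (Out : X → List X) (D : ℕ) where

    private
      -- The pairs with `y ∈ Out x` inside `xs` number at most `length xs * D`, so some `a` lies in
      -- `Out y` for at most `D` of the `y`. Once the rest is coloured, `a` has to avoid at most `D`
      -- colours from `Out a` and `D` from these `y`, so one of `D + D + 1` colours is free.
      colour : ∀ n xs → length xs ≤ n → Unique xs → (∀ {x} → x ∈ xs → length (Out x) ≤ D) →
        ∃ λ (c : X → Fin (suc (D + D))) → ∀ {x y} → x ∈ xs → y ∈ xs → y ∈ Out x → y ≢ x → c x ≢ c y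
      colour n [] _ _ _ = (λ _ → zero) , λ ()
      colour (suc n) xs@(x₀ ∷ xs₀) (s≤s le) u out≤ = extend (∃-low-degree x₀ xs₀ xs
          (λ {y} y∈ → ℕₚ.≤-trans (unique-⊆⇒length≤ (Uniqueₚ.filter⁺ (_∈? Out y) u) (λ a∈ → proj₂ (∈-filter⁻ (_∈? Out y) {xs = xs} a∈))) (out≤ y∈))
          ℕₚ.≤-refl)
        where
        open DoubleCounting (λ a y → a ∈? Out y)
        extend : (∃ λ a → a ∈ xs × degree xs a ≤ D) →
          ∃ λ (c : X → Fin (suc (D + D))) → ∀ {x y} → x ∈ xs → y ∈ xs → y ∈ Out x → y ≢ x → c x ≢ c y
        extend (a , a∈ , deg≤) with colour n (remove a xs) (ℕₚ.≤-pred (ℕₚ.≤-trans (length-remove< xs a∈) (s≤s le)))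
            (Uniqueₚ.filter⁺ (λ x → ¬? (x ≟ a)) u) (λ x∈ → out≤ (proj₁ (∈-filter⁻ (λ x → ¬? (x ≟ a)) x∈)))
        ... | c₀ , proper₀ with fresh (map c₀ (Out a) ++ map c₀ (filter (λ y → a ∈? Out y) xs)) (ℕₚ.≤-trans (ℕₚ.≤-reflexive
            (trans (length-++ (map c₀ (Out a))) (cong₂ _+_ (length-map c₀ (Out a)) (length-map c₀ (filter (λ y → a ∈? Out y) xs)))))
            (ℕₚ.+-mono-≤ (out≤ a∈) deg≤))
        ... | new , new∉ = c , proper
          where
          c : X → Fin (suc (D + D))
          c x with x ≟ a
          ... | yes _ = new
          ... | no _  = c₀ x
          proper : ∀ {x y} → x ∈ xs → y ∈ xs → y ∈ Out x → y ≢ x → c x ≢ c y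
          proper {x} {y} x∈ y∈ o y≢x eq with x ≟ a | y ≟ a
          ... | yes refl | yes refl = y≢x refl
          ... | yes refl | no _ = new∉ (∈-++⁺ˡ (subst (_∈ map c₀ (Out a)) (sym eq) (∈-map⁺ c₀ o)))
          ... | no _ | yes refl = new∉ (∈-++⁺ʳ (map c₀ (Out a)) (subst (_∈ map c₀ (filter (λ z → a ∈? Out z) xs)) eq
                  (∈-map⁺ c₀ (∈-filter⁺ (λ z → a ∈? Out z) x∈ o))))
          ... | no x≢ | no y≢ = proper₀ (∈-remove x∈ x≢) (∈-remove y∈ y≢) o y≢x eq

    ∃-proper-colouring : ∀ xs → Unique xs → (∀ {x} → x ∈ xs → length (Out x) ≤ D) →
      ∃ λ (c : X → Fin (suc (D + D))) → ∀ {x y} → x ∈ xs → y ∈ xs → y ∈ Out x → y ≢ x → c x ≢ c y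
    ∃-proper-colouring xs = colour (length xs) xs ℕₚ.≤-refl

  module _ {E : Set} (src tgt : E → X) (D : ℕ) where

    -- A bound on the maximum average degree: no vertex set `A` spans more than `D` edges per
    -- vertex. The quantification over sublists makes it pass to subgraphs.
    Sparse : List E → Set
    Sparse es = ∀ A es′ → Unique A → Unique es′ →
      (∀ {e} → e ∈ es′ → e ∈ es × src e ∈ A × tgt e ∈ A) → length es′ ≤ length A * D

    Incident : X → E → Set
    Incident a e = a ≡ src e ⊎ a ≡ tgt e

    incident? : ∀ a e → Dec (Incident a e)
    incident? a e = (a ≟ src e) ⊎-dec (a ≟ tgt e)

    record Orientation (es : List E) : Set where
      field
        In       : X → List E
        In-bound : ∀ x → length (In x) ≤ D + D
        In-sound : ∀ {x e} → e ∈ In x → e ∈ es × Incident x e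
        In-cover : ∀ {e} → e ∈ es → e ∈ In (src e) ⊎ e ∈ In (tgt e)

    private
      -- Each edge has at most two ends, so sparsity yields a vertex `a` incident to at most `D + D`
      -- edges. All edges at `a` are directed into it, and the others are oriented after its
      -- removal.
      orient : ∀ n A es → length A ≤ n → Unique A → Unique es → (∀ {e} → e ∈ es → src e ∈ A × tgt e ∈ A) → Sparse es → Orientation es
      orient n [] es le uA ues ends sp = record
        { In = λ _ → []
        ; In-bound = λ _ → z≤n
        ; In-sound = λ ()
        ; In-cover = λ e∈ → case proj₁ (ends e∈) of λ ()
        }
      orient (suc n) A@(a₀ ∷ A₀) es (s≤s le) uA ues ends sp = extend (∃-low-degree {k = 2} a₀ A₀ es
          (λ {e} e∈ → unique-⊆⇒length≤ {ys = src e ∷ tgt e ∷ []} (Uniqueₚ.filter⁺ (λ x → incident? x e) uA) λ x∈ →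
            case proj₂ (∈-filter⁻ (λ x → incident? x e) {xs = A} x∈) of λ
              { (inj₁ p) → here p ; (inj₂ p) → there (here p) })
          (ℕₚ.≤-trans (ℕₚ.*-monoˡ-≤ 2 (sp A es uA ues λ e∈ → e∈ , ends e∈)) (ℕₚ.≤-reflexive
            (trans (ℕₚ.*-assoc (length A) D 2) (cong (length A *_) (trans (ℕₚ.*-comm D 2) (cong (D +_) (ℕₚ.+-identityʳ D))))))))
        where
        open DoubleCounting incident?
        extend : (∃ λ a → a ∈ A × degree es a ≤ D + D) → Orientation es
        extend (a , a∈ , deg≤) = record { In = In ; In-bound = bound ; In-sound = sound ; In-cover = cover }
          where
          rest∈ : ∀ {e} → e ∈ filter (¬? ∘ incident? a) es → e ∈ es × ¬ Incident a e
          rest∈ = ∈-filter⁻ (¬? ∘ incident? a)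
          rest-ends : ∀ {e} → e ∈ filter (¬? ∘ incident? a) es → src e ∈ remove a A × tgt e ∈ remove a A
          rest-ends e∈ = let (e∈es , ¬i) = rest∈ e∈ in
            ∈-remove (proj₁ (ends e∈es)) (λ p → ¬i (inj₁ (sym p))) , ∈-remove (proj₂ (ends e∈es)) (λ p → ¬i (inj₂ (sym p)))
          rest : Orientation (filter (¬? ∘ incident? a) es)
          rest = orient n (remove a A) (filter (¬? ∘ incident? a) es)
            (ℕₚ.≤-pred (ℕₚ.≤-trans (length-remove< A a∈) (s≤s le)))
            (Uniqueₚ.filter⁺ (λ x → ¬? (x ≟ a)) uA) (Uniqueₚ.filter⁺ (¬? ∘ incident? a) ues) rest-ends
            (λ A′ es′ uA′ ues′ h → sp A′ es′ uA′ ues′ λ e∈ → proj₁ (rest∈ (proj₁ (h e∈))) , proj₂ (h e∈))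
          module O = Orientation rest
          In : X → List E
          In x with x ≟ a
          ... | yes _ = filter (incident? a) es
          ... | no _  = O.In x
          bound : ∀ x → length (In x) ≤ D + D
          bound x with x ≟ a
          ... | yes _ = deg≤
          ... | no _  = O.In-bound x
          sound : ∀ {x e} → e ∈ In x → e ∈ es × Incident x e
          sound {x} e∈ with x ≟ a
          ... | yes refl = ∈-filter⁻ (incident? a) e∈
          ... | no _ = let (e∈r , i) = O.In-sound e∈ in proj₁ (rest∈ e∈r) , i
          In-a : ∀ {x e} → e ∈ es → Incident a e → a ≡ x → e ∈ In x
          In-a {x} e∈ i a≡x with x ≟ a
          ... | yes _ = ∈-filter⁺ (incident? a) e∈ i
          ... | no ¬p = ⊥-elim (¬p (sym a≡x))
          In-other : ∀ {x e} → x ≢ a → e ∈ O.In x → e ∈ In x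
          In-other {x} x≢a e∈ with x ≟ a
          ... | yes p = ⊥-elim (x≢a p)
          ... | no _ = e∈
          cover : ∀ {e} → e ∈ es → e ∈ In (src e) ⊎ e ∈ In (tgt e)
          cover {e} e∈ with incident? a e
          ... | yes (inj₁ p) = inj₁ (In-a e∈ (inj₁ p) p)
          ... | yes (inj₂ p) = inj₂ (In-a e∈ (inj₂ p) p)
          ... | no ¬i with O.In-cover (∈-filter⁺ (¬? ∘ incident? a) e∈ ¬i)
          ...   | inj₁ q = inj₁ (In-other (λ p → ¬i (inj₁ (sym p))) q)
          ...   | inj₂ q = inj₂ (In-other (λ p → ¬i (inj₂ (sym p))) q)

    ∃-orientation : ∀ A es → Unique A → Unique es → (∀ {e} → e ∈ es → src e ∈ A × tgt e ∈ A) → Sparse es → Orientation es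
    ∃-orientation A es = orient (length A) A es ℕₚ.≤-refl

-- Walks and shallow topological minors

module Walks (G : Graph) where

  open Graph G using (_~_)

  private
    V = Graph.Vertex G

  ~-sym : ∀ {u v} → u ~ v → v ~ u
  ~-sym {u} {v} = subst T (Graph.adjSym G u v)

  ~⇒≢ : ∀ {u v} → u ~ v → u ≢ v
  ~⇒≢ {u} e refl = subst T (Graph.irrefl G u) e

  -- The list holds the internal vertices of the walk.
  Walk : V → List V → V → Set
  Walk x []      y = x ~ y
  Walk x (z ∷ p) y = x ~ z × Walk z p y

  walk-++ : ∀ {x z y} p {q} → Walk x p z → Walk z q y → Walk x (p ++ z ∷ q) y
  walk-++ []      w       w′ = w , w′
  walk-++ (_ ∷ p) (e , w) w′ = e , walk-++ p w w′

  walk-reverse : ∀ {x y} p → Walk x p y → Walk y (reverse p) x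
  walk-reverse []      w = ~-sym w
  walk-reverse {x} {y} (z ∷ p) (e , w) = subst (λ q → Walk y q x) (sym (unfold-reverse z p))
    (walk-++ (reverse p) (walk-reverse p w) (~-sym e))

  walk⇒linked : ∀ {x y} p → Walk x p y → Linked _~_ (x ∷ p ++ [ y ])
  walk⇒linked []      w       = w ∷ [-]
  walk⇒linked (_ ∷ p) (e , w) = e ∷ walk⇒linked p w

  open import Data.List.Membership.DecPropositional (Finₚ._≟_ {Graph.order G}) using (_∈?_)

  dropThrough : V → List V → List V
  dropThrough x []      = []
  dropThrough x (z ∷ p) with x Finₚ.≟ z
  ... | yes _ = p
  ... | no _  = dropThrough x p

  -- The tail is erased first. If it returns to `x`, everything up to that return is dropped; a walk
  -- that has reached `y` stops there.
  eraseLoops : V → List V → V → List V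
  eraseLoops x []      y = []
  eraseLoops x (z ∷ p) y with z Finₚ.≟ y
  ... | yes _ = []
  ... | no _ with x ∈? (z ∷ eraseLoops z p y)
  ...   | yes _ = dropThrough x (z ∷ eraseLoops z p y)
  ...   | no _  = z ∷ eraseLoops z p y

  -- `⊆orig` keeps every internal vertex on the original walk, so bounds on the number of walks
  -- through a vertex survive the erasure.
  record SimplePath (x : V) (p : List V) (y : V) (orig : List V) : Set where
    field
      walk   : Walk x p y
      unique : Unique p
      src∉   : x ∉ p
      tgt∉   : y ∉ p
      ⊆orig  : ∀ {v} → v ∈ p → v ∈ orig
      short  : length p ≤ length orig

  dropThrough-simple : ∀ {x w y orig} p → Walk w p y → Unique p → y ∉ p → (∀ {v} → v ∈ p → v ∈ orig) → length p ≤ length orig →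
                       x ∈ p → SimplePath x (dropThrough x p) y orig
  dropThrough-simple {x} (z ∷ p) (_ , w) (z∉ ∷ u) y∉ sub le x∈ with x Finₚ.≟ z
  ... | yes refl = record { walk = w ; unique = u ; src∉ = λ i → All.lookup z∉ i refl ; tgt∉ = y∉ ∘ there
                          ; ⊆orig = sub ∘ there ; short = ℕₚ.≤-trans (ℕₚ.n≤1+n _) le }
  ... | no x≢z = dropThrough-simple p w u (y∉ ∘ there) (sub ∘ there) (ℕₚ.≤-trans (ℕₚ.n≤1+n _) le)
                   (case x∈ of λ { (here q) → ⊥-elim (x≢z q) ; (there i) → i })

  eraseLoops-simple : ∀ x p y → x ≢ y → Walk x p y → SimplePath x (eraseLoops x p y) y p
  eraseLoops-simple x [] y x≢y w = record { walk = w ; unique = [] ; src∉ = λ () ; tgt∉ = λ () ; ⊆orig = λ () ; short = z≤n }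
  eraseLoops-simple x (z ∷ p) y x≢y (e , w) with z Finₚ.≟ y
  ... | yes refl = record { walk = e ; unique = [] ; src∉ = λ () ; tgt∉ = λ () ; ⊆orig = λ () ; short = z≤n }
  ... | no z≢y with x ∈? (z ∷ eraseLoops z p y)
  ...   | yes x∈ = dropThrough-simple (z ∷ eraseLoops z p y) (e , S.walk) u y∉ sub (s≤s S.short) x∈
    where
    module S = SimplePath (eraseLoops-simple z p y z≢y w)
    u : Unique (z ∷ eraseLoops z p y)
    u = Allₚ.¬Any⇒All¬ _ S.src∉ ∷ S.unique
    y∉ : y ∉ z ∷ eraseLoops z p y
    y∉ (here q)  = z≢y (sym q)
    y∉ (there i) = S.tgt∉ i
    sub : ∀ {v} → v ∈ z ∷ eraseLoops z p y → v ∈ z ∷ p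
    sub (here q)  = here q
    sub (there i) = there (S.⊆orig i)
  ...   | no x∉ = record
    { walk = e , S.walk ; unique = Allₚ.¬Any⇒All¬ _ S.src∉ ∷ S.unique ; src∉ = x∉
    ; tgt∉ = λ { (here q) → z≢y (sym q) ; (there i) → S.tgt∉ i }
    ; ⊆orig = λ { (here q) → here q ; (there i) → there (S.⊆orig i) }
    ; short = s≤s S.short }
    where module S = SimplePath (eraseLoops-simple z p y z≢y w)

  SamePair : V → V → V → V → Set
  SamePair a b c d = (a ≡ c × b ≡ d) ⊎ (a ≡ d × b ≡ c)

  samePair? : ∀ a b c d → Dec (SamePair a b c d)
  samePair? a b c d = (a Finₚ.≟ c) ×-dec (b Finₚ.≟ d) ⊎-dec (a Finₚ.≟ d) ×-dec (b Finₚ.≟ c)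

  samePair-flip : ∀ {a b c d} → SamePair a b c d → SamePair b a c d
  samePair-flip (inj₁ (p , q)) = inj₂ (q , p)
  samePair-flip (inj₂ (p , q)) = inj₁ (q , p)

  samePair-sym : ∀ {a b c d} → SamePair a b c d → SamePair c d a b
  samePair-sym (inj₁ (p , q)) = inj₁ (sym p , sym q)
  samePair-sym (inj₂ (p , q)) = inj₂ (sym q , sym p)

  samePair-trans : ∀ {a b c d e f} → SamePair a b c d → SamePair c d e f → SamePair a b e f
  samePair-trans (inj₁ (refl , refl)) s = s
  samePair-trans (inj₂ (refl , refl)) s = samePair-flip s

  ∈-concat-tabulate⁻ : ∀ {n} (f : Fin n → List V) {v} → v ∈ concat (tabulate f) → ∃ λ i → v ∈ f i
  ∈-concat-tabulate⁻ f v∈ with ∈-concat⁻′ (tabulate f) v∈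
  ... | xs , v∈xs , xs∈ with ∈-tabulate⁻ xs∈
  ...   | i , refl = i , v∈xs

  -- A `≤ s`-subdivision given only by its paths in `G`, before a graph `H` is known. `distinct`
  -- compares unordered pairs of ends and rules out parallel edges.
  record DisjointPaths (s M : ℕ) (branches : List V) : Set where
    field
      src tgt   : Fin M → V
      int       : Fin M → List V
      src≢tgt   : ∀ i → src i ≢ tgt i
      src∈      : ∀ i → src i ∈ branches
      tgt∈      : ∀ i → tgt i ∈ branches
      distinct  : ∀ i j → SamePair (src i) (tgt i) (src j) (tgt j) → i ≡ j
      int-walk  : ∀ i → Walk (src i) (int i) (tgt i)
      int-short : ∀ i → length (int i) ≤ s
      int-uniq  : ∀ i → Unique (int i)
      int-avoid : ∀ i {v} → v ∈ int i → v ∉ branches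
      int-disj  : ∀ i j {v} → v ∈ int i → v ∈ int j → i ≡ j

  reverse-unique : {xs : List V} → Unique xs → Unique (reverse xs)
  reverse-unique {[]} u = []
  reverse-unique {x ∷ xs} (x∉ ∷ u) = subst Unique (sym (unfold-reverse x xs))
    (Uniqueₚ.++⁺ (reverse-unique u) ([] ∷ []) λ { (i , here refl) → All.lookup x∉ (Anyₚ.reverse⁻ i) refl })

  module TopologicalMinor {s M bl} (bl! : Unique bl) (paths : DisjointPaths s M bl) where

    open DisjointPaths paths

    Match : Fin (length bl) → Fin (length bl) → Fin M → Set
    Match a b i = SamePair (lookup bl a) (lookup bl b) (src i) (tgt i)

    match? : ∀ a b → Dec (∃ (Match a b))
    match? a b = Finₚ.any? λ i → samePair? _ _ _ _

    H : Graph
    H = record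
      { order = length bl
      ; adj = λ a b → does (match? a b)
      ; adjSym = λ a b → does-⇔ (mk⇔ (λ (i , m) → i , samePair-flip m) (λ (i , m) → i , samePair-flip m)) (match? a b) (match? b a)
      ; irrefl = λ a → dec-false (match? a a) λ
          { (i , inj₁ (p , q)) → src≢tgt i (trans (sym p) q)
          ; (i , inj₂ (p , q)) → src≢tgt i (trans (sym q) p) }
      }

    edge-pair : ∀ e → let (a , b) = lookup (edges H) e in a Fin.< b × ∃ (Match a b)
    edge-pair e with proj₂ (∈-filter⁻ (edge? (Graph.adj H)) {xs = cartesianProduct (allFin _) (allFin _)} (∈-lookup {xs = edges H} e))
    ... | a<b , t = a<b , toWitness {a? = match? _ _} (subst T (sym (isYes≗does (match? _ _))) t)

    source target : Edge H → Fin (length bl)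
    source e = proj₁ (lookup (edges H) e)
    target e = proj₂ (lookup (edges H) e)

    index : Edge H → Fin M
    index e = proj₁ (proj₂ (edge-pair e))

    match : ∀ e → Match (source e) (target e) (index e)
    match e = proj₂ (proj₂ (edge-pair e))

    -- Edges of `H` are listed from the smaller index to the larger, while the path may run the
    -- other way and then has to be reversed.
    directed : ∀ {a b} {i} → Match a b i → List V
    directed {i = i} (inj₁ _) = int i
    directed {i = i} (inj₂ _) = reverse (int i)

    directed-walk : ∀ {a b i} (m : Match a b i) → Walk (lookup bl a) (directed m) (lookup bl b)
    directed-walk {a} {b} {i} (inj₁ (p , q)) rewrite p | q = int-walk i
    directed-walk {a} {b} {i} (inj₂ (p , q)) rewrite p | q = walk-reverse (int i) (int-walk i)

    directed-unique : ∀ {a b i} (m : Match a b i) → Unique (directed m)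
    directed-unique {i = i} (inj₁ _) = int-uniq i
    directed-unique {i = i} (inj₂ _) = reverse-unique (int-uniq i)

    directed-short : ∀ {a b i} (m : Match a b i) → length (directed m) ≤ s
    directed-short {i = i} (inj₁ _) = int-short i
    directed-short {i = i} (inj₂ _) = subst (_≤ s) (sym (length-reverse (int i))) (int-short i)

    directed⊆ : ∀ {a b i} (m : Match a b i) {v} → v ∈ directed m → v ∈ int i
    directed⊆ (inj₁ _) = id
    directed⊆ (inj₂ _) = Anyₚ.reverse⁻

    edges! : Unique (edges H)
    edges! = Uniqueₚ.filter⁺ (edge? (Graph.adj H)) (Uniqueₚ.cartesianProduct⁺ (Uniqueₚ.allFin⁺ _) (Uniqueₚ.allFin⁺ _))

    -- Edges served by the same path have the same pair of ends, and the crossed case contradicts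
    -- that each is listed with its smaller end first.
    index-injective : ∀ {e e′} → index e ≡ index e′ → e ≡ e′
    index-injective {e} {e′} eq = lookup-injective edges! (go (samePair-trans (match e)
        (subst (λ i → SamePair (src i) (tgt i) _ _) (sym eq) (samePair-sym (match e′)))))
      where
      go : SamePair (lookup bl (source e)) (lookup bl (target e)) (lookup bl (source e′)) (lookup bl (target e′)) →
           lookup (edges H) e ≡ lookup (edges H) e′
      go (inj₁ (p , q)) = cong₂ _,_ (lookup-injective bl! p) (lookup-injective bl! q)
      go (inj₂ (p , q)) = ⊥-elim (Finₚ.<-asym (proj₁ (edge-pair e))
        (subst₂ Fin._<_ (sym (lookup-injective bl! q)) (sym (lookup-injective bl! p)) (proj₁ (edge-pair e′))))

    minor : ShallowTopMinor s H G
    minor = record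
      { branch = lookup bl
      ; path   = λ e → directed (match e)
      ; short  = λ e → directed-short (match e)
      ; walk   = λ e → walk⇒linked (directed (match e)) (directed-walk (match e))
      ; unique = Uniqueₚ.++⁺ (Uniqueₚ.tabulate⁺ (lookup-injective bl!))
          (Uniqueₚ.concat⁺ (Allₚ.tabulate⁺ λ e → directed-unique (match e))
            (AllPairsₚ.tabulate⁺ λ e≢e′ (v∈ , v∈′) →
              e≢e′ (index-injective (int-disj _ _ (directed⊆ (match _) v∈) (directed⊆ (match _) v∈′)))))
          apart
      }
      where
      apart : ∀ {v} → ¬ (v ∈ tabulate (lookup bl) × v ∈ concat (tabulate (λ e → directed (match e))))
      apart (v∈ , v∈c) =
        let (a , v≡) = ∈-tabulate⁻ {f = lookup bl} v∈
            (e , v∈e) = ∈-concat-tabulate⁻ (λ e → directed (match e)) v∈c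
        in int-avoid (index e) (directed⊆ (match e) v∈e) (subst (_∈ bl) (sym v≡) (∈-lookup a))

    -- Each path supplies the edge between the positions of its ends, put in increasing order;
    -- `distinct` makes this assignment injective.
    size≥ : M ≤ size H
    size≥ = Finₚ.injective⇒≤ {f = λ i → proj₁ (edgeOf i)} λ {i} {j} eq →
        distinct i j (samePair-trans (samePair-sym (proj₂ (edgeOf i)))
          (subst (λ e → SamePair (lookup bl (source e)) (lookup bl (target e)) _ _) (sym eq) (proj₂ (edgeOf j))))
      where
      place : ∀ a b {i} → a Fin.< b → Match a b i → ∃ λ e → Match (source e) (target e) i
      place a b {i} a<b m = Any.index ab∈ , subst (λ (a , b) → Match a b i) (∈-lookup⇒index ab∈) m
        where
        ab∈ : (a , b) ∈ edges H
        ab∈ = ∈-filter⁺ (edge? (Graph.adj H)) (∈-cartesianProduct⁺ (∈-allFin a) (∈-allFin b))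
          (a<b , subst T (isYes≗does (match? a b)) (fromWitness {a? = match? a b} (i , m)))
      edgeOf : ∀ i → ∃ λ e → Match (source e) (target e) i
      edgeOf i with Finₚ.<-cmp (Any.index (src∈ i)) (Any.index (tgt∈ i))
      ... | tri< lt _ _ = place _ _ lt (inj₁ (sym (∈-lookup⇒index (src∈ i)) , sym (∈-lookup⇒index (tgt∈ i))))
      ... | tri≈ _ eq _ = ⊥-elim (src≢tgt i (trans (∈-lookup⇒index (src∈ i)) (trans (cong (lookup bl) eq) (sym (∈-lookup⇒index (tgt∈ i))))))
      ... | tri> _ _ gt = place _ _ gt (inj₂ (sym (∈-lookup⇒index (tgt∈ i)) , sym (∈-lookup⇒index (src∈ i))))

-- Density of families of walks

unrelated⇒≡ : ∀ {A : Set} {R : A → A → Set} → (∀ {x y} → R x y → R y x) → ∀ {xs} → AllPairs (λ x y → ¬ R x y) xs →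
             ∀ {x y} → x ∈ xs → y ∈ xs → R x y → x ≡ y
unrelated⇒≡ R-sym (_ ∷ _)  (here refl) (here refl) r = refl
unrelated⇒≡ R-sym (x∉ ∷ _) (here refl) (there y∈)  r = ⊥-elim (All.lookup x∉ y∈ r)
unrelated⇒≡ R-sym (x∉ ∷ _) (there x∈)  (here refl) r = ⊥-elim (All.lookup x∉ x∈ (R-sym r))
unrelated⇒≡ R-sym (_ ∷ u)  (there x∈)  (there y∈)  r = unrelated⇒≡ R-sym u x∈ y∈ r

-- Greedy choice: an element is added only if it is related to no representative chosen already.
∃-representatives : ∀ {A : Set} {R : A → A → Set} → (∀ x y → Dec (R x y)) → (∀ {x} → R x x) → ∀ xs →
  ∃ λ ys → (∀ {y} → y ∈ ys → y ∈ xs) × AllPairs (λ x y → ¬ R x y) ys × (∀ {x} → x ∈ xs → ∃ λ y → y ∈ ys × R x y)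
∃-representatives R? R-refl [] = [] , (λ ()) , [] , λ ()
∃-representatives R? R-refl (x ∷ xs) with ∃-representatives R? R-refl xs
... | ys , sub , ap , cover with any? (R? x) ys
...   | yes r = ys , there ∘ sub , ap , λ { (here refl) → find r ; (there i) → cover i }
...   | no ¬r = x ∷ ys , (λ { (here p) → here p ; (there i) → there (sub i) }) , Allₚ.¬Any⇒All¬ ys ¬r ∷ ap ,
                λ { (here refl) → x , here refl , R-refl ; (there i) → let (y , y∈ , r) = cover i in y , there y∈ , r }

-- The vertex colouring uses 4T + 1 colours, the colouring of the walks 2sT + 1.
walkDensity : (s T d : ℕ) → ℕ
walkDensity s T d = suc ((T + T) + (T + T)) * (suc ((T + T) + (T + T)) * suc (s * T + s * T)) * d

module Density (G : Graph) (s d : ℕ) (sparse : ∀ H → ShallowTopMinor s H G → size H ≤ d * Graph.order H) where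

  open Walks G

  V : Set
  V = Graph.Vertex G

  Triple : Set
  Triple = V × List V × V

  src tgt : Triple → V
  src (x , _ , _) = x
  tgt (_ , _ , y) = y

  int : Triple → List V
  int (_ , p , _) = p

  _≟ᵀ_ : DecidableEquality Triple
  _≟ᵀ_ = ≡-dec Finₚ._≟_ (≡-dec (Listₚ.≡-dec Finₚ._≟_) Finₚ._≟_)

  Same : Triple → Triple → Set
  Same m m′ = SamePair (src m) (tgt m) (src m′) (tgt m′)

  -- `through v` is a list of at most `T` triples that contains all walks of `cs` with internal
  -- vertex `v`, and possibly others. Such a superset suffices for both colourings below.
  record WalkFamily (T : ℕ) (cs : List Triple) : Set where
    field
      ends≢        : ∀ {m} → m ∈ cs → src m ≢ tgt m
      walk         : ∀ {m} → m ∈ cs → Walk (src m) (int m) (tgt m)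
      short        : ∀ {m} → m ∈ cs → length (int m) ≤ s
      through      : V → List Triple
      through≤     : ∀ v → length (through v) ≤ T
      ∈-through    : ∀ {m v} → m ∈ cs → v ∈ int m → m ∈ through v

  module _ {T cs} (fam : WalkFamily T cs) where

    open WalkFamily fam

    private
      erased : Triple → List V
      erased m = eraseLoops (src m) (int m) (tgt m)

      simple : ∀ {m} → m ∈ cs → SimplePath (src m) (erased m) (tgt m) (int m)
      simple {m} m∈ = eraseLoops-simple (src m) (int m) (tgt m) (ends≢ m∈) (walk m∈)

    module ColourClasses {A ms} (A! : Unique A) (ms! : Unique ms)
      (distinct : ∀ {m m′} → m ∈ ms → m′ ∈ ms → Same m m′ → m ≡ m′)
      (ms⊆ : ∀ {m} → m ∈ ms → m ∈ cs × src m ∈ A × tgt m ∈ A)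
      {K₁ K₂} (c₁ : V → Fin K₁) (c₂ : Triple → Fin K₂)
      (c₁-src : ∀ {m v} → m ∈ ms → v ∈ erased m → c₁ v ≢ c₁ (src m))
      (c₁-tgt : ∀ {m v} → m ∈ ms → v ∈ erased m → c₁ v ≢ c₁ (tgt m))
      (c₂-disjoint : ∀ {m m′ v} → m ∈ ms → m′ ∈ ms → v ∈ erased m → v ∈ erased m′ → c₂ m ≡ c₂ m′ → m ≡ m′)
      where

      Colour : Set
      Colour = Fin K₁ × Fin K₁ × Fin K₂

      _≟ᶜ_ : DecidableEquality Colour
      _≟ᶜ_ = ≡-dec Finₚ._≟_ (≡-dec Finₚ._≟_ Finₚ._≟_)

      col : Triple → Colour
      col m = c₁ (src m) , c₁ (tgt m) , c₂ m

      module _ (α β : Fin K₁) (γ : Fin K₂) where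

        class : List Triple
        class = filter (λ m → col m ≟ᶜ (α , β , γ)) ms

        branch? : ∀ v → Dec (c₁ v ≡ α ⊎ c₁ v ≡ β)
        branch? v = (c₁ v Finₚ.≟ α) ⊎-dec (c₁ v Finₚ.≟ β)

        member∈ : ∀ i → lookup class i ∈ ms
        member∈ i = proj₁ (∈-filter⁻ (λ m → col m ≟ᶜ (α , β , γ)) (∈-lookup {xs = class} i))

        member-col : ∀ i → col (lookup class i) ≡ (α , β , γ)
        member-col i = proj₂ (∈-filter⁻ (λ m → col m ≟ᶜ (α , β , γ)) {xs = ms} (∈-lookup {xs = class} i))

        member-injective : ∀ {i j} → lookup class i ≡ lookup class j → i ≡ j
        member-injective = lookup-injective (Uniqueₚ.filter⁺ (λ m → col m ≟ᶜ (α , β , γ)) ms!)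

        -- All ends in the class are coloured `α` or `β`, and `c₁` keeps the internal vertices of a
        -- walk away from the colours of its own ends, hence away from every branch vertex of the
        -- class.
        avoid : ∀ {m v} → m ∈ ms → col m ≡ (α , β , γ) → v ∈ erased m → ¬ (c₁ v ≡ α ⊎ c₁ v ≡ β)
        avoid m∈ refl v∈ (inj₁ p) = c₁-src m∈ v∈ p
        avoid m∈ refl v∈ (inj₂ p) = c₁-tgt m∈ v∈ p

        paths : DisjointPaths s (length class) (filter branch? A)
        paths = record
          { src = λ i → src (lookup class i)
          ; tgt = λ i → tgt (lookup class i)
          ; int = λ i → erased (lookup class i)
          ; src≢tgt = λ i → ends≢ (proj₁ (ms⊆ (member∈ i)))
          ; src∈ = λ i → ∈-filter⁺ branch? (proj₁ (proj₂ (ms⊆ (member∈ i)))) (inj₁ (cong proj₁ (member-col i)))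
          ; tgt∈ = λ i → ∈-filter⁺ branch? (proj₂ (proj₂ (ms⊆ (member∈ i)))) (inj₂ (cong (proj₁ ∘ proj₂) (member-col i)))
          ; distinct = λ i j same → member-injective (distinct (member∈ i) (member∈ j) same)
          ; int-walk = λ i → SimplePath.walk (simple (proj₁ (ms⊆ (member∈ i))))
          ; int-short = λ i → ℕₚ.≤-trans (SimplePath.short (simple (proj₁ (ms⊆ (member∈ i))))) (short (proj₁ (ms⊆ (member∈ i))))
          ; int-uniq = λ i → SimplePath.unique (simple (proj₁ (ms⊆ (member∈ i))))
          ; int-avoid = λ i v∈ v∈b → avoid (member∈ i) (member-col i) v∈ (proj₂ (∈-filter⁻ branch? {xs = A} v∈b))
          ; int-disj = λ i j v∈ v∈′ → member-injective (c₂-disjoint (member∈ i) (member∈ j) v∈ v∈′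
              (cong (proj₂ ∘ proj₂) (trans (member-col i) (sym (member-col j)))))
          }

        class≤ : length class ≤ length A * d
        class≤ = ℕₚ.≤-trans (TopologicalMinor.size≥ A′! paths)
          (ℕₚ.≤-trans (sparse (TopologicalMinor.H A′! paths) (TopologicalMinor.minor A′! paths))
          (ℕₚ.≤-trans (ℕₚ.≤-reflexive (ℕₚ.*-comm d (length (filter branch? A)))) (ℕₚ.*-monoˡ-≤ d (length-filter branch? A))))
          where
          A′! : Unique (filter branch? A)
          A′! = Uniqueₚ.filter⁺ branch? A!

      colours : List Colour
      colours = cartesianProduct (allFin K₁) (cartesianProduct (allFin K₁) (allFin K₂))

      length-colours : length colours ≡ K₁ * (K₁ * K₂)
      length-colours = trans (length-cartesianProduct (allFin K₁) _) (cong₂ _*_ (length-tabulate {n = K₁} id)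
        (trans (length-cartesianProduct (allFin K₁) (allFin K₂)) (cong₂ _*_ (length-tabulate {n = K₁} id) (length-tabulate {n = K₂} id))))

      ∈-colours : ∀ κ → κ ∈ colours
      ∈-colours (α , β , γ) = ∈-cartesianProduct⁺ (∈-allFin α) (∈-cartesianProduct⁺ (∈-allFin β) (∈-allFin γ))

      length≤ : length ms ≤ length A * (K₁ * (K₁ * K₂) * d)
      length≤ = ℕₚ.≤-trans (pigeonhole _≟ᶜ_ col colours ms (λ _ → ∈-colours _) (λ (α , β , γ) → class≤ α β γ))
        (ℕₚ.≤-reflexive (trans (cong (_* (length A * d)) length-colours) (rearrange (K₁ * (K₁ * K₂)) (length A) d)))
        where
        rearrange : ∀ a b c → a * (b * c) ≡ b * (a * c)
        rearrange a b c = trans (sym (ℕₚ.*-assoc a b c)) (trans (cong (_* c) (ℕₚ.*-comm a b)) (ℕₚ.*-assoc b a c))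

    -- The first colouring separates the ends of a walk from its internal vertices, the second
    -- one separates intersecting walks, so each class of walks with prescribed colours is
    -- the edge set of a shallow topological minor.
    length≤walkDensity : ∀ A ms → Unique A → Unique ms → (∀ {m m′} → m ∈ ms → m′ ∈ ms → Same m m′ → m ≡ m′) →
      (∀ {m} → m ∈ ms → m ∈ cs × src m ∈ A × tgt m ∈ A) → length ms ≤ length A * walkDensity s T d
    length≤walkDensity A ms A! ms! distinct ms⊆
      with Peeling.∃-proper-colouring Finₚ._≟_
        -- Every vertex points to the ends of the walks through it, and every walk to the walks
        -- through its internal vertices.
        (λ v → map src (through v) ++ map tgt (through v)) (T + T) (allFin _) (Uniqueₚ.allFin⁺ _)
        (λ {v} _ → ℕₚ.≤-trans (ℕₚ.≤-reflexive (trans (length-++ (map src (through v))) (cong₂ _+_ (length-map src (through v)) (length-map tgt (through v)))))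
          (ℕₚ.+-mono-≤ (through≤ v) (through≤ v)))
      | Peeling.∃-proper-colouring _≟ᵀ_ (λ m → concatMap through (int m)) (s * T) ms ms!
        (λ {m} m∈ → ℕₚ.≤-trans (length-concatMap≤ through (int m) (λ {v} _ → through≤ v)) (ℕₚ.*-monoˡ-≤ T (short (proj₁ (ms⊆ m∈)))))
    ... | c₁ , c₁-proper | c₂ , c₂-proper = ColourClasses.length≤ A! ms! distinct ms⊆ c₁ c₂ c₁-src c₁-tgt c₂-disjoint
      where
      ∈-through′ : ∀ {m v} → m ∈ ms → v ∈ erased m → m ∈ through v
      ∈-through′ m∈ v∈ = let m∈cs = proj₁ (ms⊆ m∈) in ∈-through m∈cs (SimplePath.⊆orig (simple m∈cs) v∈)
      c₁-src : ∀ {m v} → m ∈ ms → v ∈ erased m → c₁ v ≢ c₁ (src m)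
      c₁-src {m} {v} m∈ v∈ = c₁-proper (∈-allFin v) (∈-allFin (src m)) (∈-++⁺ˡ (∈-map⁺ src (∈-through′ m∈ v∈)))
        λ p → SimplePath.src∉ (simple (proj₁ (ms⊆ m∈))) (subst (_∈ erased m) (sym p) v∈)
      c₁-tgt : ∀ {m v} → m ∈ ms → v ∈ erased m → c₁ v ≢ c₁ (tgt m)
      c₁-tgt {m} {v} m∈ v∈ = c₁-proper (∈-allFin v) (∈-allFin (tgt m)) (∈-++⁺ʳ (map src (through v)) (∈-map⁺ tgt (∈-through′ m∈ v∈)))
        λ p → SimplePath.tgt∉ (simple (proj₁ (ms⊆ m∈))) (subst (_∈ erased m) (sym p) v∈)
      c₂-disjoint : ∀ {m m′ v} → m ∈ ms → m′ ∈ ms → v ∈ erased m → v ∈ erased m′ → c₂ m ≡ c₂ m′ → m ≡ m′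
      c₂-disjoint {m} {m′} m∈ m′∈ v∈ v∈′ eq with m′ ≟ᵀ m
      ... | yes p = sym p
      ... | no ¬p = ⊥-elim (c₂-proper m∈ m′∈
        (∈-concatMap⁺ through (lose (SimplePath.⊆orig (simple (proj₁ (ms⊆ m∈))) v∈) (∈-through′ m′∈ v∈′))) ¬p eq)

    -- An arc is a walk of `cs` read forwards or backwards. `In-cover` may return a different walk
    -- `q`, since one walk stands for all those with the same pair of ends.
    record OrientedWalks (B : ℕ) : Set where
      field
        In       : V → List (V × List V)
        In-bound : ∀ z → length (In z) ≤ B
        In-sound : ∀ {x p z} → (x , p) ∈ In z → (x , p , z) ∈ cs ⊎ ∃ λ q → p ≡ reverse q × (z , q , x) ∈ cs
        In-cover : ∀ {x p y} → (x , p , y) ∈ cs → ∃ λ q → (x , q) ∈ In y ⊎ (y , q) ∈ In x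

    arc : V → Triple → V × List V
    arc z (x , p , y) with z Finₚ.≟ y
    ... | yes _ = x , p
    ... | no _  = y , reverse p

    arc-sound : ∀ z m {x p} → m ∈ cs → z ≡ src m ⊎ z ≡ tgt m → (x , p) ≡ arc z m →
                (x , p , z) ∈ cs ⊎ ∃ λ q → p ≡ reverse q × (z , q , x) ∈ cs
    arc-sound z (a , p , b) m∈ inc eq with z Finₚ.≟ b
    arc-sound z (a , p , b) m∈ inc refl | yes refl = inj₁ m∈
    arc-sound z (a , p , b) m∈ (inj₁ refl) refl | no _ = inj₂ (p , refl , m∈)
    arc-sound z (a , p , b) m∈ (inj₂ q) eq | no ¬p = ⊥-elim (¬p q)

    arc-tgt : ∀ a p b → arc b (a , p , b) ≡ (a , p)
    arc-tgt a p b with b Finₚ.≟ b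
    ... | yes _ = refl
    ... | no ¬p = ⊥-elim (¬p refl)

    arc-src : ∀ a p b → a ≢ b → arc a (a , p , b) ≡ (b , reverse p)
    arc-src a p b a≢b with a Finₚ.≟ b
    ... | yes q = ⊥-elim (a≢b q)
    ... | no _ = refl

    orientWalks : ∀ {D ms} → (∀ {m} → m ∈ ms → m ∈ cs) → (∀ {c} → c ∈ cs → ∃ λ m → m ∈ ms × Same c m) →
                  Peeling.Orientation Finₚ._≟_ src tgt D ms → OrientedWalks (D + D)
    orientWalks {D} {ms} ms⊆cs cover O = record
      { In = λ z → map (arc z) (O.In z)
      ; In-bound = λ z → subst (_≤ D + D) (sym (length-map (arc z) (O.In z))) (O.In-bound z)
      ; In-sound = λ {x} {p} {z} xp∈ → let (m , m∈ , eq) = ∈-map⁻ (arc z) xp∈; (m∈ms , inc) = O.In-sound m∈ in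
          arc-sound z m (ms⊆cs m∈ms) inc eq
      ; In-cover = covered
      }
      where
      module O = Peeling.Orientation O
      oriented : ∀ {m} → m ∈ ms → ∃ λ q → (src m , q) ∈ map (arc (tgt m)) (O.In (tgt m)) ⊎ (tgt m , q) ∈ map (arc (src m)) (O.In (src m))
      oriented {a , p , b} m∈ with O.In-cover m∈
      ... | inj₁ i = reverse p , inj₂ (subst (_∈ map (arc a) (O.In a)) (arc-src a p b (ends≢ (ms⊆cs m∈))) (∈-map⁺ (arc a) i))
      ... | inj₂ i = p , inj₁ (subst (_∈ map (arc b) (O.In b)) (arc-tgt a p b) (∈-map⁺ (arc b) i))
      covered : ∀ {x p y} → (x , p , y) ∈ cs → ∃ λ q → (x , q) ∈ map (arc y) (O.In y) ⊎ (y , q) ∈ map (arc x) (O.In x)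
      covered c∈ with cover c∈
      ... | m , m∈ , same with oriented m∈ | same
      ...   | q , o | inj₁ (refl , refl) = q , o
      ...   | q , o | inj₂ (refl , refl) = q , swap o

    -- Keeping one walk for each unordered pair of ends leaves a simple graph on the vertices. By
    -- `length≤walkDensity` it is sparse on every vertex set, so it has an orientation with indegree
    -- at most twice that density.
    ∃-orientedWalks : OrientedWalks (walkDensity s T d + walkDensity s T d)
    ∃-orientedWalks =
      let (ms , ms⊆cs , ms-apart , cover) = ∃-representatives {R = Same} (λ m m′ → samePair? (src m) (tgt m) (src m′) (tgt m′)) (inj₁ (refl , refl)) cs
          distinct = λ {m} {m′} → unrelated⇒≡ {R = Same} samePair-sym ms-apart {m} {m′}
      in orientWalks ms⊆cs cover (Peeling.∃-orientation Finₚ._≟_ src tgt (walkDensity s T d) (allFin (Graph.order G)) ms (Uniqueₚ.allFin⁺ _)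
        (AllPairs.map (λ { ¬s refl → ¬s (inj₁ (refl , refl)) }) ms-apart)
        (λ _ → ∈-allFin _ , ∈-allFin _)
        λ A ms′ A! ms′! h → length≤walkDensity A ms′ A! ms′!
          (λ m∈ m′∈ → distinct (proj₁ (h m∈)) (proj₁ (h m′∈))) (λ m∈ → ms⊆cs (proj₁ (h m∈)) , proj₂ (h m∈)))

-- Fraternal augmentation

-- `K` bounds the joined walks through a vertex, according to whether it is the common head or
-- interior to the first or the second arc. The sum dominates both the indegree `M + 2D` and the
-- number `M + 2K` of walks through a vertex, each new walk being counted in both directions.
stepBound : (s d M : ℕ) → ℕ
stepBound s d M = M + ((D + D) + (K + K))
  where
  K = M * M + (M * M + M * M)
  D = walkDensity s K d

stageBound : (s d t : ℕ) → ℕ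
stageBound s d zero    = walkDensity s 0 d + walkDensity s 0 d
stageBound s d (suc t) = stepBound s d (stageBound s d t)

module Augmentation (G : Graph) (s d : ℕ) (sparse : ∀ H → ShallowTopMinor s H G → size H ≤ d * Graph.order H) where

  open Walks G
  open Density G s d sparse
  open Graph G using (_~_)

  -- (x , p) ∈ In z is an arc from x to z of weight 1 + length p, represented by a walk of G.
  -- All pairs of arcs of total weight at most t with a common head have adjacent tails.
  record Stage (t M : ℕ) : Set where
    field
      In        : V → List (V × List V)
      In-bound  : ∀ z → length (In z) ≤ M
      In-walk   : ∀ {x p z} → (x , p) ∈ In z → Walk x p z
      through   : V → List Triple
      through≤  : ∀ v → length (through v) ≤ M
      ∈-through : ∀ {x p z v} → (x , p) ∈ In z → v ∈ p → (x , p , z) ∈ through v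
      adjacent  : ∀ {x y} → x ~ y → (x , []) ∈ In y ⊎ (y , []) ∈ In x
      fraternal : ∀ {x p y q z} → (x , p) ∈ In z → (y , q) ∈ In z → x ≢ y → 2 + (length p + length q) ≤ t →
                  ∃ λ p′ → length p′ ≡ 1 + (length p + length q) × ((x , p′) ∈ In y ⊎ (y , p′) ∈ In x)

  module Initial where

    adjacent? : (e : V × V) → Dec (proj₁ e ~ proj₂ e)
    adjacent? (x , y) = T? (Graph.adj G x y)

    arrow : V × V → Triple
    arrow (x , y) = x , [] , y

    cs : List Triple
    cs = map arrow (filter adjacent? (cartesianProduct (allFin _) (allFin _)))

    cs⁻ : ∀ {x p y} → (x , p , y) ∈ cs → x ~ y × p ≡ []
    cs⁻ c∈ with ∈-map⁻ arrow c∈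
    ... | e , e∈ , refl = proj₂ (∈-filter⁻ adjacent? {xs = cartesianProduct (allFin _) (allFin _)} e∈) , refl

    ∉-empty : ∀ {p : List V} → p ≡ [] → ∀ {v} {A : Set} → v ∈ p → A
    ∉-empty refl ()

    family : WalkFamily 0 cs
    family = record
      { ends≢     = λ {(x , p , y)} c∈ → ~⇒≢ (proj₁ (cs⁻ c∈))
      ; walk      = λ {(x , p , y)} c∈ → let (e , p≡[]) = cs⁻ c∈ in subst (λ p → Walk x p y) (sym p≡[]) e
      ; short     = λ {(x , p , y)} c∈ → subst (λ p → length p ≤ s) (sym (proj₂ (cs⁻ c∈))) z≤n
      ; through   = λ _ → []
      ; through≤  = λ _ → z≤n
      ; ∈-through = λ {(x , p , y)} c∈ → ∉-empty (proj₂ (cs⁻ c∈))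
      }

    module _ {D} (O : OrientedWalks family D) where

      private
        module O = OrientedWalks O

      arc-[] : ∀ {x p z} → (x , p) ∈ O.In z → Walk x p z × p ≡ []
      arc-[] xp∈ with O.In-sound xp∈
      ... | inj₁ c∈ with cs⁻ c∈
      ...   | e , refl = e , refl
      arc-[] xp∈ | inj₂ (q , p≡ , c∈) with cs⁻ c∈
      arc-[] xp∈ | inj₂ (q , refl , c∈) | e , refl = ~-sym e , refl

      adjacent : ∀ {x y} → x ~ y → (x , []) ∈ O.In y ⊎ (y , []) ∈ O.In x
      adjacent {x} {y} e with O.In-cover {x} {[]} {y} (∈-map⁺ arrow (∈-filter⁺ adjacent? (∈-cartesianProduct⁺ (∈-allFin x) (∈-allFin y)) e))
      ... | q , inj₁ i = inj₁ (subst (λ q → (x , q) ∈ O.In y) (proj₂ (arc-[] i)) i)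
      ... | q , inj₂ i = inj₂ (subst (λ q → (y , q) ∈ O.In x) (proj₂ (arc-[] i)) i)

      stage : Stage 1 D
      stage = record
        { In        = O.In
        ; In-bound  = O.In-bound
        ; In-walk   = λ xp∈ → proj₁ (arc-[] xp∈)
        ; through   = λ _ → []
        ; through≤  = λ _ → z≤n
        ; ∈-through = λ xp∈ → ∉-empty (proj₂ (arc-[] xp∈))
        ; adjacent  = adjacent
        -- Two arcs have total weight at least 2, so the weight bound 1 leaves nothing to join.
        ; fraternal = λ { _ _ _ (s≤s ()) }
        }

  initial : Stage 1 (stageBound s d 0)
  initial = Initial.stage (∃-orientedWalks Initial.family)

  module Step {t M : ℕ} (t≤s : t ≤ s) (S : Stage t M) where

    private
      module S = Stage S

    Arc : Set
    Arc = V × List V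

    -- Both arcs end in `z`, so the second walk is traversed backwards.
    join : V → Arc × Arc → Triple
    join z ((x , p) , (y , q)) = x , p ++ z ∷ reverse q , y

    -- The total weight is exactly `t + 1`: lighter pairs are handled by earlier stages, and the
    -- joined walk has `t` internal vertices.
    Joinable : Arc × Arc → Set
    Joinable ((x , p) , (y , q)) = x ≢ y × 2 + (length p + length q) ≡ suc t

    joinable? : ∀ ab → Dec (Joinable ab)
    joinable? ((x , p) , (y , q)) = ¬? (x Finₚ.≟ y) ×-dec (2 + (length p + length q) ℕₚ.≟ suc t)

    pairs : V → List (Arc × Arc)
    pairs z = filter joinable? (cartesianProduct (S.In z) (S.In z))

    cs : List Triple
    cs = concatMap (λ z → map (join z) (pairs z)) (allFin _)

    record Joined (m : Triple) : Set where
      constructor joined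
      field
        {x y z}  : V
        {p q}    : List V
        xp∈      : (x , p) ∈ S.In z
        yq∈      : (y , q) ∈ S.In z
        joinable : Joinable ((x , p) , (y , q))
        m≡       : m ≡ join z ((x , p) , (y , q))

    cs⁻ : ∀ {m} → m ∈ cs → Joined m
    cs⁻ m∈ with find (∈-concatMap⁻ (λ z → map (join z) (pairs z)) {xs = allFin _} m∈)
    ... | z , _ , m∈z with ∈-map⁻ (join z) m∈z
    ...   | ab , ab∈ , m≡ with ∈-filter⁻ joinable? {xs = cartesianProduct (S.In z) (S.In z)} ab∈
    ...     | ab∈× , j with ∈-cartesianProduct⁻ (S.In z) (S.In z) ab∈×
    ...       | a∈ , b∈ = joined a∈ b∈ j m≡

    cs⁺ : ∀ {z x p y q} → (x , p) ∈ S.In z → (y , q) ∈ S.In z → Joinable ((x , p) , (y , q)) → join z ((x , p) , (y , q)) ∈ cs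
    cs⁺ {z} a∈ b∈ j = ∈-concatMap⁺ (λ z → map (join z) (pairs z))
      (lose (∈-allFin z) (∈-map⁺ (join z) (∈-filter⁺ joinable? (∈-cartesianProduct⁺ a∈ b∈) j)))

    length-int : ∀ {m} → m ∈ cs → length (int m) ≡ t
    length-int m∈ with cs⁻ m∈
    ... | joined {z = z} {p = p} {q = q} _ _ (_ , eq) refl = trans (length-++ p)
      (trans (ℕₚ.+-suc (length p) (length (reverse q))) (trans (cong (λ k → suc (length p + k)) (length-reverse q)) (ℕₚ.suc-injective eq)))

    walk-cs : ∀ {m} → m ∈ cs → Walk (src m) (int m) (tgt m)
    walk-cs m∈ with cs⁻ m∈
    ... | joined {p = p} {q = q} a∈ b∈ _ refl = walk-++ p (S.In-walk a∈) (walk-reverse q (S.In-walk b∈))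

    ends≢-cs : ∀ {m} → m ∈ cs → src m ≢ tgt m
    ends≢-cs m∈ with cs⁻ m∈
    ... | joined _ _ (x≢y , _) refl = x≢y

    joinˡ joinʳ : Triple → List Triple
    joinˡ (x , p , z) = map (λ b → join z ((x , p) , b)) (S.In z)
    joinʳ (y , q , z) = map (λ a → join z (a , (y , q))) (S.In z)

    through : V → List Triple
    through v = map (join v) (cartesianProduct (S.In v) (S.In v)) ++ (concatMap joinˡ (S.through v) ++ concatMap joinʳ (S.through v))

    through≤ : ∀ v → length (through v) ≤ M * M + (M * M + M * M)
    through≤ v = ≤-++ (map (join v) (cartesianProduct (S.In v) (S.In v)))
        (ℕₚ.≤-trans (ℕₚ.≤-reflexive (trans (length-map (join v) (cartesianProduct (S.In v) (S.In v))) (length-cartesianProduct (S.In v) (S.In v))))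
          (ℕₚ.*-mono-≤ (S.In-bound v) (S.In-bound v)))
        (≤-++ (concatMap joinˡ (S.through v))
          (concat≤ joinˡ (λ (x , p , z) → ℕₚ.≤-trans (ℕₚ.≤-reflexive (length-map (λ b → join z ((x , p) , b)) (S.In z))) (S.In-bound z)))
          (concat≤ joinʳ (λ (y , q , z) → ℕₚ.≤-trans (ℕₚ.≤-reflexive (length-map (λ a → join z (a , (y , q))) (S.In z))) (S.In-bound z))))
      where
      ≤-++ : ∀ (xs : List Triple) {ys a b} → length xs ≤ a → length ys ≤ b → length (xs ++ ys) ≤ a + b
      ≤-++ xs l l′ = ℕₚ.≤-trans (ℕₚ.≤-reflexive (length-++ xs)) (ℕₚ.+-mono-≤ l l′)
      concat≤ : (f : Triple → List Triple) → (∀ m → length (f m) ≤ M) → length (concatMap f (S.through v)) ≤ M * M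
      concat≤ f f≤ = ℕₚ.≤-trans (length-concatMap≤ f (S.through v) (λ {m} _ → f≤ m)) (ℕₚ.*-monoˡ-≤ M (S.through≤ v))

    ∈-through : ∀ {m v} → m ∈ cs → v ∈ int m → m ∈ through v
    ∈-through {v = v} m∈ v∈ with cs⁻ m∈
    ... | joined {x} {y} {z} {p} {q} a∈ b∈ _ refl with ∈-++⁻ p v∈
    ...   | inj₁ v∈p = ∈-++⁺ʳ (map (join v) (cartesianProduct (S.In v) (S.In v))) (∈-++⁺ˡ
              (∈-concatMap⁺ joinˡ (lose (S.∈-through a∈ v∈p) (∈-map⁺ (λ b → join z ((x , p) , b)) b∈))))
    ...   | inj₂ (here refl) = ∈-++⁺ˡ (∈-map⁺ (join z) (∈-cartesianProduct⁺ a∈ b∈))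
    ...   | inj₂ (there v∈q) = ∈-++⁺ʳ (map (join v) (cartesianProduct (S.In v) (S.In v))) (∈-++⁺ʳ (concatMap joinˡ (S.through v))
              (∈-concatMap⁺ joinʳ (lose (S.∈-through b∈ (Anyₚ.reverse⁻ v∈q)) (∈-map⁺ (λ a → join z (a , (y , q))) a∈))))

    family : WalkFamily (M * M + (M * M + M * M)) cs
    family = record
      { ends≢     = ends≢-cs
      ; walk      = walk-cs
      ; short     = λ m∈ → subst (_≤ s) (sym (length-int m∈)) t≤s
      ; through   = through
      ; through≤  = through≤
      ; ∈-through = ∈-through
      }

    flip : Triple → Triple
    flip (x , p , y) = y , reverse p , x

    module _ {D} (O : OrientedWalks family D) where

      private
        module O = OrientedWalks O

      In : V → List Arc
      In z = S.In z ++ O.In z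

      -- The flipped copies account for joined walks that the orientation reverses.
      through′ : V → List Triple
      through′ v = S.through v ++ (through v ++ map flip (through v))

      new-walk : ∀ {x p z} → (x , p) ∈ O.In z → Walk x p z
      new-walk xp∈ with O.In-sound xp∈
      ... | inj₁ c∈ = walk-cs c∈
      ... | inj₂ (q , refl , c∈) = walk-reverse q (walk-cs c∈)

      new-length : ∀ {x p z} → (x , p) ∈ O.In z → length p ≡ t
      new-length xp∈ with O.In-sound xp∈
      ... | inj₁ c∈ = length-int c∈
      ... | inj₂ (q , refl , c∈) = trans (length-reverse q) (length-int c∈)

      new-through : ∀ {x p z v} → (x , p) ∈ O.In z → v ∈ p → (x , p , z) ∈ through v ++ map flip (through v)
      new-through {v = v} xp∈ v∈ with O.In-sound xp∈
      ... | inj₁ c∈ = ∈-++⁺ˡ (∈-through c∈ v∈)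
      ... | inj₂ (q , refl , c∈) = ∈-++⁺ʳ (through v) (∈-map⁺ flip (∈-through c∈ (Anyₚ.reverse⁻ v∈)))

      inject : ∀ {a x b y} → a ∈ S.In x ⊎ b ∈ S.In y → a ∈ In x ⊎ b ∈ In y
      inject (inj₁ i) = inj₁ (∈-++⁺ˡ i)
      inject (inj₂ i) = inj₂ (∈-++⁺ˡ i)

      -- A new arc has weight `t + 1` already, so with any second arc the total exceeds `t + 1`.
      -- Hence both arcs are old; a total of at most `t` is settled by the previous stage, and
      -- `t + 1` by the new arcs.
      fraternal : ∀ {x p y q z} → (x , p) ∈ In z → (y , q) ∈ In z → x ≢ y → 2 + (length p + length q) ≤ suc t →
                  ∃ λ p′ → length p′ ≡ 1 + (length p + length q) × ((x , p′) ∈ In y ⊎ (y , p′) ∈ In x)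
      fraternal {x} {p} {y} {q} {z} a∈ b∈ x≢y le with ∈-++⁻ (S.In z) a∈ | ∈-++⁻ (S.In z) b∈
      ... | inj₂ a∈ | _ = ⊥-elim (ℕₚ.<⇒≱ (s≤s (ℕₚ.m≤m+n (length p) (length q))) (subst (suc (length p + length q) ≤_) (sym (new-length a∈)) (ℕₚ.≤-pred le)))
      ... | inj₁ _ | inj₂ b∈ = ⊥-elim (ℕₚ.<⇒≱ (s≤s (ℕₚ.m≤n+m (length q) (length p))) (subst (suc (length p + length q) ≤_) (sym (new-length b∈)) (ℕₚ.≤-pred le)))
      ... | inj₁ a∈ | inj₁ b∈ with ℕₚ.m≤n⇒m<n∨m≡n le
      ...   | inj₁ lt = let (p′ , eq , i) = S.fraternal a∈ b∈ x≢y (ℕₚ.≤-pred lt) in p′ , eq , inject i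
      ...   | inj₂ eq with O.In-cover (cs⁺ a∈ b∈ (x≢y , eq))
      ...     | p′ , inj₁ i = p′ , trans (new-length i) (sym (ℕₚ.suc-injective eq)) , inj₁ (∈-++⁺ʳ (S.In y) i)
      ...     | p′ , inj₂ i = p′ , trans (new-length i) (sym (ℕₚ.suc-injective eq)) , inj₂ (∈-++⁺ʳ (S.In x) i)

      extend : Stage (suc t) (M + (D + ((M * M + (M * M + M * M)) + (M * M + (M * M + M * M)))))
      extend = record
        { In        = In
        ; In-bound  = λ z → ≤-trans (≤-reflexive (length-++ (S.In z))) (+-mono-≤ (S.In-bound z) (≤-trans (O.In-bound z) (m≤m+n D _)))
        ; In-walk   = λ {x} {p} {z} a∈ → case ∈-++⁻ (S.In z) a∈ of λ { (inj₁ i) → S.In-walk i ; (inj₂ i) → new-walk i }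
        ; through   = through′
        ; through≤  = λ v → ≤-trans (≤-reflexive (trans (length-++ (S.through v)) (cong (length (S.through v) +_)
            (trans (length-++ (through v)) (cong (length (through v) +_) (length-map flip (through v)))))))
            (+-mono-≤ (S.through≤ v) (≤-trans (+-mono-≤ (through≤ v) (through≤ v)) (m≤n+m _ D)))
        ; ∈-through = λ {x} {p} {z} {v} a∈ v∈ → case ∈-++⁻ (S.In z) a∈ of λ
            { (inj₁ i) → ∈-++⁺ˡ (S.∈-through i v∈) ; (inj₂ i) → ∈-++⁺ʳ (S.through v) (new-through i v∈) }
        ; adjacent  = inject ∘ S.adjacent
        ; fraternal = fraternal
        }
        where open ℕₚ using (≤-trans; ≤-reflexive; +-mono-≤; m≤m+n; m≤n+m)

    next : Stage (suc t) (stepBound s d M)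
    next = extend (∃-orientedWalks family)

  -- Arcs of weight at most `t + 1` have at most `t ≤ s` internal vertices, so all walks stay within
  -- the permitted length `s`.
  ∃-stage : ∀ t → t ≤ s → Stage (suc t) (stageBound s d t)
  ∃-stage zero    _ = initial
  ∃-stage (suc t) l = Step.next l (∃-stage t (ℕₚ.≤-trans (ℕₚ.n≤1+n t) l))

-- Paths have a vertex of unique colour

data Step {A : Set} (u v : A) : List A → Set where
  here  : ∀ {xs} → Step u v (u ∷ v ∷ xs)
  there : ∀ {x xs} → Step u v xs → Step u v (x ∷ xs)

module _ {A : Set} {u v : A} where

  step-++ˡ : ∀ {xs ys} → Step u v xs → Step u v (xs ++ ys)
  step-++ˡ here      = here
  step-++ˡ (there p) = there (step-++ˡ p)

  step-++ʳ : ∀ xs {ys} → Step u v ys → Step u v (xs ++ ys)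
  step-++ʳ []       p = p
  step-++ʳ (_ ∷ xs) p = there (step-++ʳ xs p)

  step-∈ : ∀ {xs} → Step u v xs → u ∈ xs × v ∈ xs
  step-∈ here      = here refl , there (here refl)
  step-∈ (there p) = let (u∈ , v∈) = step-∈ p in there u∈ , there v∈

IsPath : (G : Graph) → List (Graph.Vertex G) → Set
IsPath G xs = Unique xs × (∀ {u v} → Step u v xs → Graph._~_ G u v)

-- A form of centred colouring restricted to paths; `ℓ` counts edges, so the paths have up to
-- `ℓ + 1` vertices.
Rooted : (G : Graph) {K : ℕ} → (Graph.Vertex G → Fin K) → ℕ → Set
Rooted G c ℓ = ∀ x xs → IsPath G (x ∷ xs) → length xs ≤ ℓ →
  ∃ λ s → s ∈ x ∷ xs × (∀ {v} → v ∈ x ∷ xs → v ≢ s → c v ≢ c s)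

-- `D` bounds the number of ancestors within `(s + 1) * (s + 1)` arcs when indegrees are at most
-- `stageBound s d s`.
vertexColours : (s d : ℕ) → ℕ
vertexColours s d = suc (D + D)
  where D = suc (stageBound s d s) ^ (suc s * suc s)

module Roots (G : Graph) (s d : ℕ) (sparse : ∀ H → ShallowTopMinor s H G → size H ≤ d * Graph.order H)
             {t M : ℕ} (S : Augmentation.Stage G s d sparse t M) where

  open Augmentation.Stage S

  private
    V = Graph.Vertex G

  Anc : ℕ → V → List V
  Anc zero    v = [ v ]
  Anc (suc m) v = v ∷ concatMap (λ a → Anc m (proj₁ a)) (In v)

  length-Anc≤ : ∀ m v → length (Anc m v) ≤ suc M ^ m
  length-Anc≤ zero    v = s≤s z≤n
  length-Anc≤ (suc m) v = ℕₚ.+-mono-≤ (ℕₚ.m^n>0 (suc M) m)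
    (ℕₚ.≤-trans (length-concatMap≤ (λ a → Anc m (proj₁ a)) (In v) (λ {a} _ → length-Anc≤ m (proj₁ a))) (ℕₚ.*-monoˡ-≤ (suc M ^ m) (In-bound v)))

  Anc-self : ∀ m {v} → v ∈ Anc m v
  Anc-self zero    = here refl
  Anc-self (suc m) = here refl

  Anc-arc : ∀ {m x y z p} → x ∈ Anc m y → (y , p) ∈ In z → x ∈ Anc (suc m) z
  Anc-arc {m} x∈ a∈ = there (∈-concatMap⁺ (λ a → Anc m (proj₁ a)) (lose a∈ x∈))

  Anc-suc : ∀ m {x y} → x ∈ Anc m y → x ∈ Anc (suc m) y
  Anc-suc zero    (here refl) = here refl
  Anc-suc (suc m) (here refl) = here refl
  Anc-suc (suc m) {y = y} (there x∈) with find (∈-concatMap⁻ (λ a → Anc m (proj₁ a)) {xs = In y} x∈)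
  ... | a , a∈ , x∈a = Anc-arc {suc m} (Anc-suc m x∈a) a∈

  Anc-mono : ∀ {m n x y} → m ≤ n → x ∈ Anc m y → x ∈ Anc n y
  Anc-mono {m} {x = x} {y} m≤n x∈ = go (ℕₚ.≤⇒≤′ m≤n)
    where
    go : ∀ {n} → m ≤′ n → x ∈ Anc n y
    go (≤′-reflexive refl) = x∈
    go (≤′-step {n} l)     = Anc-suc n (go l)

  Anc-trans : ∀ m n {x y z} → x ∈ Anc m y → y ∈ Anc n z → x ∈ Anc (n + m) z
  Anc-trans m zero    x∈ (here refl) = x∈
  Anc-trans m (suc n) x∈ (here refl) = Anc-mono (ℕₚ.m≤n+m m (suc n)) x∈
  Anc-trans m (suc n) {z = z} x∈ (there y∈) with find (∈-concatMap⁻ (λ a → Anc n (proj₁ a)) {xs = In z} y∈)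
  ... | a , a∈ , y∈a = Anc-arc {n + m} (Anc-trans m n x∈ y∈a) a∈

  -- A shortcut of a path from a to b without internal sinks: arcs lead backwards from a to some
  -- vertex, from which b is reached along directed arcs.
  data SinkFree (L : List V) (b : V) : V → ℕ → Set where
    top : ∀ {a m w} → a ∈ L → a ∈ Anc m b → m ≤ w → SinkFree L b a w
    up  : ∀ {a c p w} → a ∈ L → (c , p) ∈ In a → SinkFree L b c w → SinkFree L b a (suc (length p) + w)

  first∈ : ∀ {L b a w} → SinkFree L b a w → a ∈ L
  first∈ (top a∈ _ _) = a∈
  first∈ (up a∈ _ _)  = a∈

  weaken : ∀ {L b a w x} → SinkFree L b a w → SinkFree (x ∷ L) b a w
  weaken (top a∈ i l)  = top (there a∈) i l
  weaken (up a∈ i s) = up (there a∈) i (weaken s)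

  -- An internal sink is bypassed by a fraternal arc.
  prepend : ∀ {L a b c w p} → (a , p) ∈ In c ⊎ (c , p) ∈ In a → SinkFree L b c w → a ∉ L → suc (length p) + w ≤ t →
            SinkFree (a ∷ L) b a (suc (length p) + w)
  prepend (inj₂ i) sf a∉ le = up (here refl) i (weaken sf)
  prepend {b = b} {w = w} {p} (inj₁ i) (top {m = m} c∈ c∈Anc m≤w) a∉ le =
    top (here refl) (Anc-trans 1 m (Anc-arc {0} (here refl) i) c∈Anc)
      (ℕₚ.≤-trans (ℕₚ.≤-reflexive (ℕₚ.+-comm m 1)) (s≤s (ℕₚ.≤-trans m≤w (ℕₚ.m≤n+m w (length p)))))
  -- Both arcs enter the sink `c`. The fraternal arc between `a` and `c′` weighs as much as the two
  -- together, so the weight is preserved and the recursion goes on at `c′`.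
  prepend {a = a} {b} {p = p} (inj₁ i) (up {c = c′} {q} {w} c∈ j sf) a∉ le
    with fraternal i j (λ { refl → a∉ (first∈ sf) }) (ℕₚ.≤-trans (ℕₚ.m≤m+n _ w) (ℕₚ.≤-trans (ℕₚ.≤-reflexive (sym weight)) le))
    where
    weight : suc (length p) + (suc (length q) + w) ≡ 2 + (length p + length q) + w
    weight = cong suc (trans (ℕₚ.+-suc (length p) (length q + w)) (cong suc (sym (ℕₚ.+-assoc (length p) (length q) w))))
  ... | p′ , eq , link = subst (SinkFree _ b a) weight′ (prepend link sf a∉ (ℕₚ.≤-trans (ℕₚ.≤-reflexive weight′) le))
    where
    weight′ : suc (length p′) + w ≡ suc (length p) + (suc (length q) + w)
    weight′ = trans (cong (λ k → suc k + w) eq)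
      (sym (cong suc (trans (ℕₚ.+-suc (length p) (length q + w)) (cong suc (sym (ℕₚ.+-assoc (length p) (length q) w))))))

  -- Built from the far end towards `x`. Edges of `G` are arcs of weight 1, so the weight stays at
  -- most the number of edges and never exceeds `t`, as bypassing requires.
  sinkFree : ∀ {b} x xs → IsPath G (x ∷ xs) → b ∈ x ∷ xs → length xs ≤ t → ∃ λ w → w ≤ length xs × SinkFree (x ∷ xs) b x w
  sinkFree x xs path (here refl) le = 0 , z≤n , top (here refl) (here refl) (z≤n {0})
  sinkFree x (y ∷ ys) (x∉ ∷ u , adj) (there b∈) le with sinkFree y ys (u , adj ∘ there) b∈ (ℕₚ.≤-trans (ℕₚ.n≤1+n _) le)
  ... | w , w≤ , sf = suc w , s≤s w≤ , prepend (adjacent (adj here)) sf (λ i → All.lookup x∉ i refl) (ℕₚ.≤-trans (s≤s w≤) le)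

  -- The witness is the vertex at which the backward arcs from `a` stop; from it directed arcs lead
  -- both to `a` and to `b`.
  commonAncestor : ∀ {L a b w} → SinkFree L b a w → ∃ λ s → s ∈ L × s ∈ Anc w a × s ∈ Anc w b
  commonAncestor {a = a} {w = w} (top a∈ i m≤w) = a , a∈ , Anc-self w , Anc-mono m≤w i
  commonAncestor (up {p = p} {w} a∈ i sf) with commonAncestor sf
  ... | s , s∈ , sc , sb = s , s∈ , Anc-mono (s≤s (ℕₚ.m≤n+m w (length p))) (Anc-arc sc i) , Anc-mono (ℕₚ.m≤n+m w (suc (length p))) sb

  -- Induction along the path: a vertex of the path that is a common ancestor of `x` and of the root
  -- `s′` of the rest is above everything. Each vertex added raises the distance by at most `t`.
  root : ∀ x xs → IsPath G (x ∷ xs) → length xs ≤ t → ∃ λ s → s ∈ x ∷ xs × (∀ {v} → v ∈ x ∷ xs → s ∈ Anc (length xs * t) v)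
  root x [] path le = x , here refl , λ { (here refl) → here refl }
  root x (y ∷ ys) path@(_ ∷ u , adj) le with root y ys (u , adj ∘ there) (ℕₚ.≤-trans (ℕₚ.n≤1+n _) le)
  ... | s′ , s′∈ , anc′ with sinkFree x (y ∷ ys) path (there s′∈) le
  ...   | w , w≤ , sf with commonAncestor sf
  ...     | s , s∈ , sx , ss′ = s , s∈ , λ
    { (here refl) → Anc-mono (ℕₚ.≤-trans w≤t (ℕₚ.m≤m+n t (length ys * t))) sx
    ; {v} (there v∈) → subst (λ k → s ∈ Anc k v) (ℕₚ.+-comm (length ys * t) t) (Anc-trans t (length ys * t) (Anc-mono w≤t ss′) (anc′ v∈)) }
    where
    w≤t : w ≤ t
    w≤t = ℕₚ.≤-trans w≤ le

  ∃-rooted : ∃ λ (c : V → Fin (suc (suc M ^ (t * t) + suc M ^ (t * t)))) → Rooted G c t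
  ∃-rooted with Peeling.∃-proper-colouring Finₚ._≟_ (Anc (t * t)) (suc M ^ (t * t)) (allFin _) (Uniqueₚ.allFin⁺ _) (λ {v} _ → length-Anc≤ (t * t) v)
  ... | c , proper = c , λ x xs path le → let (s , s∈ , anc) = root x xs path le in
    s , s∈ , λ {v} v∈ v≢s → proper (∈-allFin v) (∈-allFin s) (Anc-mono (ℕₚ.*-monoˡ-≤ t le) (anc v∈)) (≢-sym v≢s)

∃-rootedColouring : ∀ G s d → (∀ H → ShallowTopMinor s H G → size H ≤ d * Graph.order H) →
  ∃ λ (c : Graph.Vertex G → Fin (vertexColours s d)) → Rooted G c (suc s)
∃-rootedColouring G s d sparse = Roots.∃-rooted G s d sparse (Augmentation.∃-stage G s d sparse s ℕₚ.≤-refl)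

-- Colouring the edges

module EdgeColouring (G : Graph) {K ℓ : ℕ} (c : Graph.Vertex G → Fin K) (rooted : Rooted G c ℓ) where

  private
    V = Graph.Vertex G

  -- The colour pair is ordered by the ends, smaller first, to agree with the listing of edges and
  -- to be independent of the direction of traversal.
  edgeColour : V → V → Fin (K * K)
  edgeColour u v with u Finₚ.<? v
  ... | yes _ = combine (c u) (c v)
  ... | no _  = combine (c v) (c u)

  edgeColour-ends : ∀ {a b u v} → edgeColour a b ≡ edgeColour u v → (c a ≡ c u ⊎ c a ≡ c v) × (c b ≡ c u ⊎ c b ≡ c v)
  edgeColour-ends {a} {b} {u} {v} eq with a Finₚ.<? b | u Finₚ.<? v
  ... | yes _ | yes _ = let (p , q) = Finₚ.combine-injective (c a) (c b) (c u) (c v) eq in inj₁ p , inj₂ q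
  ... | yes _ | no _  = let (p , q) = Finₚ.combine-injective (c a) (c b) (c v) (c u) eq in inj₂ p , inj₁ q
  ... | no _  | yes _ = let (p , q) = Finₚ.combine-injective (c b) (c a) (c u) (c v) eq in inj₂ q , inj₁ p
  ... | no _  | no _  = let (p , q) = Finₚ.combine-injective (c b) (c a) (c v) (c u) eq in inj₁ q , inj₂ p

  colouring : Colouring G (K * K)
  colouring e = let (u , v) = lookup (edges G) e in combine (c u) (c v)

  edge-ends : ∀ {e u v} → lookup (edges G) e ≡ (u , v) → u Fin.< v × Graph._~_ G u v
  edge-ends {e} eq = subst (λ (u , v) → u Fin.< v × Graph._~_ G u v) eq
    (proj₂ (∈-filter⁻ (edge? (Graph.adj G)) {xs = cartesianProduct (allFin _) (allFin _)} (∈-lookup {xs = edges G} e)))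

  joins⇒~ : ∀ {e u v} → Joins G e u v → Graph._~_ G u v
  joins⇒~ {e} (inj₁ p) = proj₂ (edge-ends {e} p)
  joins⇒~ {e} (inj₂ p) = Walks.~-sym G (proj₂ (edge-ends {e} p))

  joins⇒colour : ∀ {e u v} → Joins G e u v → colouring e ≡ edgeColour u v
  joins⇒colour {e} {u} {v} j with u Finₚ.<? v | j
  ... | yes _  | inj₁ p = cong (λ (u , v) → combine (c u) (c v)) p
  ... | yes lt | inj₂ p = ⊥-elim (Finₚ.<-asym lt (proj₁ (edge-ends {e} p)))
  ... | no ¬lt | inj₁ p = ⊥-elim (¬lt (proj₁ (edge-ends {e} p)))
  ... | no _   | inj₂ p = cong (λ (u , v) → combine (c u) (c v)) p

  ManyColours : ℕ → List V → Set
  ManyColours m xs = ∃ λ κs → Unique κs × length κs ≡ m × (∀ {κ} → κ ∈ κs → ∃₂ λ u v → Step u v xs × κ ≡ edgeColour u v)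

  -- Since `edgeColour-ends` matches each end with an end of equal colour, an edge with an end whose
  -- colour is absent from `ws` has a colour not found on `ws`.
  addColour : ∀ {m ws xs} a b → (∀ {v} → v ∈ ws → c v ≢ c a) ⊎ (∀ {v} → v ∈ ws → c v ≢ c b) → Step a b xs →
              (∀ {u v} → Step u v ws → Step u v xs) → ManyColours m ws → ManyColours (suc m) xs
  addColour {ws = ws} a b avoid step sub (κs , κs! , len , from) =
    edgeColour a b ∷ κs , All.tabulate (λ κ∈ eq → new κ∈ eq avoid) ∷ κs! , cong suc len , λ
      { (here refl) → a , b , step , refl
      ; (there κ∈) → let (u , v , st , eq) = from κ∈ in u , v , sub st , eq }
    where
    new : ∀ {κ} → κ ∈ κs → edgeColour a b ≡ κ → ¬ ((∀ {v} → v ∈ ws → c v ≢ c a) ⊎ (∀ {v} → v ∈ ws → c v ≢ c b))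
    new κ∈ eq avoid with from κ∈
    ... | u , v , st , eq′ with edgeColour-ends (trans eq eq′) | step-∈ st | avoid
    ...   | inj₁ p , _ | u∈ , v∈ | inj₁ av = av u∈ (sym p)
    ...   | inj₂ p , _ | u∈ , v∈ | inj₁ av = av v∈ (sym p)
    ...   | _ , inj₁ p | u∈ , v∈ | inj₂ av = av u∈ (sym p)
    ...   | _ , inj₂ p | u∈ , v∈ | inj₂ av = av v∈ (sym p)

  -- Two parts smaller than `2 ^ m` together with the deleted vertex give at most `2 ^ suc m - 1`
  -- vertices.
  halves : ∀ m a b → 2 ^ suc m ≤ a + suc b → 2 ^ m ≤ a ⊎ 2 ^ m ≤ b
  halves m a b le with 2 ^ m ℕₚ.≤? a | 2 ^ m ℕₚ.≤? b
  ... | yes p | _     = inj₁ p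
  ... | no _  | yes p = inj₂ p
  ... | no p  | no q  = ⊥-elim (ℕₚ.<⇒≱ (ℕₚ.≤-trans
        (ℕₚ.+-mono-≤ (ℕₚ.≰⇒> p) (ℕₚ.≰⇒> q)) (ℕₚ.≤-reflexive (cong (2 ^ m +_) (sym (ℕₚ.+-identityʳ (2 ^ m)))))) le)

  unique-++ˡ : ∀ {A : Set} (xs : List A) {ys} → Unique (xs ++ ys) → Unique xs
  unique-++ˡ []       u        = []
  unique-++ˡ (x ∷ xs) (x∉ ∷ u) = Allₚ.++⁻ˡ xs x∉ ∷ unique-++ˡ xs u

  unique-++ʳ : ∀ {A : Set} (xs : List A) {ys} → Unique (xs ++ ys) → Unique ys
  unique-++ʳ []       u       = u
  unique-++ʳ (x ∷ xs) (_ ∷ u) = unique-++ʳ xs u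

  unique-middle : ∀ {A : Set} (xs : List A) {s ys} → Unique (xs ++ s ∷ ys) → s ∉ xs × s ∉ ys
  unique-middle []       (s∉ ∷ _) = (λ ()) , λ i → All.lookup s∉ i refl
  unique-middle (x ∷ xs) (x∉ ∷ u) = let (a , b) = unique-middle xs u in
    (λ { (here refl) → All.lookup x∉ (∈-++⁺ʳ xs (here refl)) refl ; (there i) → a i }) , b

  mutual

    -- Split at the vertex of unique colour: one side keeps `2 ^ m` vertices, and the edge from it
    -- to the split vertex has a colour new to that side. The sides are shorter, so `rooted` applies
    -- to them again.
    path-manyColours : ∀ m xs → IsPath G xs → 2 ^ m ≤ length xs → length xs ≤ suc ℓ → ManyColours m xs
    path-manyColours zero    xs       path lo hi = [] , [] , refl , λ ()
    path-manyColours (suc m) []       path lo hi = ⊥-elim (ℕₚ.<⇒≱ (ℕₚ.m^n>0 2 (suc m)) lo)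
    path-manyColours (suc m) (x ∷ xs) path lo hi with rooted x xs path (ℕₚ.≤-pred hi)
    ... | s , s∈ , uniq with ∈-∃++ s∈
    ...   | ys , zs , eq = subst (ManyColours (suc m)) (sym eq) (split-manyColours m ys zs (subst (IsPath G) eq path)
              (λ v∈ → uniq (subst (_ ∈_) (sym eq) v∈))
              (subst (λ ws → 2 ^ suc m ≤ length ws) eq lo) (subst (λ ws → length ws ≤ suc ℓ) eq hi))

    split-manyColours : ∀ m ys {s} zs → IsPath G (ys ++ s ∷ zs) → (∀ {v} → v ∈ ys ++ s ∷ zs → v ≢ s → c v ≢ c s) →
      2 ^ suc m ≤ length (ys ++ s ∷ zs) → length (ys ++ s ∷ zs) ≤ suc ℓ → ManyColours (suc m) (ys ++ s ∷ zs)
    split-manyColours m ys {s} zs (u , adj) uniq lo hi with halves m (length ys) (length zs) (subst (2 ^ suc m ≤_) (length-++ ys) lo)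
    split-manyColours m ys {s} zs (u , adj) uniq lo hi | inj₁ left with initLast ys
    ... | [] = ⊥-elim (ℕₚ.<⇒≱ (ℕₚ.m^n>0 2 m) left)
    ... | ys′ ∷ʳ′ y =
      addColour y s (inj₂ λ v∈ → uniq (∈-++⁺ˡ v∈) (λ { refl → proj₁ (unique-middle ys u) v∈ }))
        (subst (Step y s) (sym (++-assoc ys′ [ y ] (s ∷ zs))) (step-++ʳ ys′ here)) step-++ˡ
        (path-manyColours m ys (unique-++ˡ ys u , adj ∘ step-++ˡ) left
          (ℕₚ.≤-trans (ℕₚ.≤-trans (ℕₚ.m≤m+n (length ys) _) (ℕₚ.≤-reflexive (sym (length-++ ys)))) hi))
    split-manyColours m ys {s} []          path      uniq lo hi | inj₂ right = ⊥-elim (ℕₚ.<⇒≱ (ℕₚ.m^n>0 2 m) right)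
    split-manyColours m ys {s} (z ∷ zs) (u , adj) uniq lo hi | inj₂ right =
      addColour s z (inj₁ λ v∈ → uniq (∈-++⁺ʳ ys (there v∈)) (λ { refl → proj₂ (unique-middle ys u) v∈ }))
        (step-++ʳ ys here) (λ st → step-++ʳ ys (there st))
        (path-manyColours m (z ∷ zs) (unique-++ʳ [ s ] (unique-++ʳ ys u) , (λ st → adj (step-++ʳ ys (there st)))) right
          (ℕₚ.≤-trans (ℕₚ.≤-trans (ℕₚ.n≤1+n _) (ℕₚ.≤-trans (ℕₚ.m≤n+m _ (length ys)) (ℕₚ.≤-reflexive (sym (length-++ ys))))) hi))

  -- Edge colours on cycles

  module OnCycle (γ : Cycle G) where

    open Cycle γ

    -- Indices are taken modulo `len`, so stretches of the cycle may begin anywhere and run past the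
    -- last vertex.
    at : ℕ → V
    at j = vertex (j mod len)

    toℕ-mod : ∀ j → toℕ (j mod len) ≡ j % len
    toℕ-mod j = Finₚ.toℕ-fromℕ< (m%n<n j len)

    suc-mod : ∀ j → suc (toℕ (j mod len)) mod len ≡ suc j mod len
    suc-mod j = Finₚ.toℕ-injective (trans (toℕ-mod (suc (toℕ (j mod len)))) (trans (cong (λ k → suc k % len) (toℕ-mod j)) (trans
      (trans (%-distribˡ-+ 1 (j % len) len) (trans (cong (λ k → (1 % len + k) % len) (m%n%n≡m%n j len)) (sym (%-distribˡ-+ 1 j len))))
      (sym (toℕ-mod (suc j))))))

    joins-at : ∀ j → Joins G (edge (j mod len)) (at j) (at (suc j))
    joins-at j = subst (λ i → Joins G (edge (j mod len)) (at j) (vertex i)) (suc-mod j) (joins (j mod len))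

    segment : ℕ → ℕ → List V
    segment a zero    = []
    segment a (suc m) = at a ∷ segment (suc a) m

    length-segment : ∀ a m → length (segment a m) ≡ m
    length-segment a zero    = refl
    length-segment a (suc m) = cong suc (length-segment (suc a) m)

    segment-step : ∀ a m {u v} → Step u v (segment a m) → ∃ λ j → u ≡ at j × v ≡ at (suc j)
    segment-step a (suc zero)    (there ())
    segment-step a (suc (suc m)) here       = a , refl , refl
    segment-step a (suc (suc m)) (there st) = segment-step (suc a) (suc m) st

    ∈-segment⁻ : ∀ a m {v} → v ∈ segment a m → ∃ λ i → i < m × v ≡ at (a + i)
    ∈-segment⁻ a (suc m) (here refl) = 0 , s≤s z≤n , cong at (sym (ℕₚ.+-identityʳ a))
    ∈-segment⁻ a (suc m) (there v∈)  = let (i , i<m , eq) = ∈-segment⁻ (suc a) m v∈ in suc i , s≤s i<m , trans eq (cong at (sym (ℕₚ.+-suc a i)))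

    ∈-segment⁺ : ∀ a {m i} → i < m → at (a + i) ∈ segment a m
    ∈-segment⁺ a {suc m} {zero}  _         = here (cong at (ℕₚ.+-identityʳ a))
    ∈-segment⁺ a {suc m} {suc i} (s≤s i<m) = there (subst (λ k → at k ∈ segment (suc a) m) (sym (ℕₚ.+-suc a i)) (∈-segment⁺ (suc a) i<m))

    at∈segment : ∀ j → at j ∈ segment 0 len
    at∈segment j = subst (_∈ segment 0 len) (cong vertex (Finₚ.toℕ-injective
        (trans (toℕ-mod (j % len)) (trans (m%n%n≡m%n j len) (sym (toℕ-mod j))))))
      (∈-segment⁺ 0 (m%n<n j len))

    -- Equal residues would make `len` divide the positive number `suc i < len`.
    at-injective : ∀ a i → suc i < len → at a ≢ at (a + suc i)
    at-injective a i lt eq = ℕₚ.<⇒≱ lt (∣⇒≤ (∣m+n∣m⇒∣n {len} {a / len * len} {suc i} (divides ((a + suc i) / len) quotient) (divides (a / len) refl)))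
      where
      same% : a % len ≡ (a + suc i) % len
      same% = trans (sym (toℕ-mod a)) (trans (cong toℕ (vertexInj eq)) (toℕ-mod (a + suc i)))
      quotient : a / len * len + suc i ≡ (a + suc i) / len * len
      quotient = ℕₚ.+-cancelˡ-≡ (a % len) _ _ (trans (sym (ℕₚ.+-assoc (a % len) (a / len * len) (suc i)))
        (trans (cong (_+ suc i) (sym (m≡m%n+[m/n]*n a len)))
        (trans (m≡m%n+[m/n]*n (a + suc i) len) (cong (_+ (a + suc i) / len * len) (sym same%)))))

    segment-unique : ∀ a m → m ≤ len → Unique (segment a m)
    segment-unique a zero    le = []
    segment-unique a (suc m) le = All.tabulate (λ v∈ eq → let (i , i<m , v≡) = ∈-segment⁻ (suc a) m v∈ in
        at-injective a i (ℕₚ.≤-trans (s≤s i<m) le) (trans eq (trans v≡ (cong at (sym (ℕₚ.+-suc a i))))))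
      ∷ segment-unique (suc a) m (ℕₚ.≤-trans (ℕₚ.n≤1+n m) le)

    segment-path : ∀ a m → m ≤ len → IsPath G (segment a m)
    segment-path a m le = segment-unique a m le , λ st → let (j , p , q) = segment-step a m st in
      subst₂ (Graph._~_ G) (sym p) (sym q) (joins⇒~ (joins-at j))

    manyColours⇒≤ : ∀ {a m n} → ManyColours n (segment a m) → n ≤ numColours {G} colouring γ
    manyColours⇒≤ {a} {m} (κs , κs! , refl , from) = unique-⊆⇒length≤ κs! λ κ∈ →
      let (u , v , st , eq) = from κ∈ ; (j , p , q) = segment-step a m st in
      ∈-deduplicate⁺ Finₚ._≟_ (subst (_∈ tabulate (colouring ∘ edge))
        (trans (joins⇒colour (joins-at j)) (sym (trans eq (cong₂ edgeColour p q)))) (∈-tabulate⁺ {f = colouring ∘ edge} (j mod len)))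

    -- Deleting the vertex of unique colour leaves a path on len - 1 vertices.
    short-cycle : len ≤ suc ℓ → ∀ m → 2 ^ m < len → ∃ λ j → ManyColours (suc m) (segment j len)
    short-cycle le m lo with rooted (at 0) (segment 1 (2 + len-3)) (segment-path 0 len ℕₚ.≤-refl)
                               (subst (_≤ ℓ) (sym (length-segment 1 (2 + len-3))) (ℕₚ.≤-pred le))
    ... | s , s∈ , uniq with ∈-segment⁻ 0 len s∈
    -- The cycle is reread starting from the vertex `at j` of unique colour; its edge to
    -- `at (suc j)` contributes the extra colour.
    ...   | j , _ , refl = j , addColour (at j) (at (suc j)) (inj₁ avoid) here there
      (path-manyColours m (segment (suc j) (2 + len-3)) (segment-path (suc j) (2 + len-3) (ℕₚ.n≤1+n _))
        (subst (2 ^ m ≤_) (sym (length-segment (suc j) (2 + len-3))) (ℕₚ.≤-pred lo))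
        (subst (_≤ suc ℓ) (sym (length-segment (suc j) (2 + len-3))) (ℕₚ.≤-trans (ℕₚ.n≤1+n _) le)))
      where
      avoid : ∀ {v} → v ∈ segment (suc j) (2 + len-3) → c v ≢ c (at j)
      avoid {v} v∈ = uniq (let (i , _ , v≡) = ∈-segment⁻ (suc j) (2 + len-3) v∈ in subst (_∈ segment 0 len) (sym v≡) (at∈segment (suc j + i)))
        λ { refl → Uniqueₚ.Unique[x∷xs]⇒x∉xs (segment-unique j len ℕₚ.≤-refl) v∈ }

  ⌈log₂⌉≡suc⇒< : ∀ {n m} → ⌈log₂ n ⌉ ≡ suc m → 2 ^ m < n
  ⌈log₂⌉≡suc⇒< {n} {m} eq = ℕₚ.≰⇒> λ n≤ → ℕₚ.1+n≰n (subst (_≤ m) eq (ℕₚ.≤-trans (⌈log₂⌉-mono-≤ n≤) (ℕₚ.≤-reflexive (⌈log₂2^n⌉≡n m))))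

  -- A cycle longer than `2 ^ suc r` contains a path on `2 ^ suc r` vertices, which already shows
  -- `r + 1` colours. Any other cycle is itself within the reach of `rooted`, and there
  -- `⌈log₂ len ⌉ ≡ suc m` means `2 ^ m < len`, so `short-cycle` applies.
  colouring-good : ∀ r → 2 ^ suc r ≤ suc ℓ → IsGood f₀ G r colouring
  colouring-good r hi γ with Cycle.len γ ℕₚ.≤? 2 ^ suc r
  ... | no ¬le = ℕₚ.≤-trans (ℕₚ.m⊓n≤n (f₀ len) (r + 1)) (ℕₚ.≤-trans (ℕₚ.≤-reflexive (ℕₚ.+-comm r 1)) (manyColours⇒≤ {0} {2 ^ suc r}
        (path-manyColours (suc r) (segment 0 (2 ^ suc r)) (segment-path 0 (2 ^ suc r) (ℕₚ.<⇒≤ (ℕₚ.≰⇒> ¬le)))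
          (ℕₚ.≤-reflexive (sym (length-segment 0 (2 ^ suc r)))) (subst (_≤ suc ℓ) (sym (length-segment 0 (2 ^ suc r))) hi))))
    where
    open Cycle γ
    open OnCycle γ
  ... | yes le with ⌈log₂ Cycle.len γ ⌉ in eq
  ...   | zero = z≤n
  ...   | suc m with OnCycle.short-cycle γ (ℕₚ.≤-trans le hi) m (⌈log₂⌉≡suc⇒< eq)
  ...     | j , many = ℕₚ.≤-trans (ℕₚ.m⊓n≤m (suc m) (r + 1)) (OnCycle.manyColours⇒≤ γ {j} {Cycle.len γ} many)

-- Polynomial bounds

-- The base `suc d` is at least 1, so exponents can be raised when bounds are added.
PolyBounded : (ℕ → ℕ) → Set
PolyBounded F = ∃₂ λ C e → ∀ d → F d ≤ C * suc d ^ e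

poly-const : ∀ k → PolyBounded (λ _ → k)
poly-const k = k , 0 , λ _ → ℕₚ.≤-reflexive (sym (ℕₚ.*-identityʳ k))

poly-id : PolyBounded (λ d → d)
poly-id = 1 , 1 , λ d → ℕₚ.≤-trans (ℕₚ.n≤1+n d) (ℕₚ.≤-reflexive (sym (trans (ℕₚ.*-identityˡ (suc d ^ 1)) (ℕₚ.*-identityʳ (suc d)))))

infixl 6 _⊕_
infixl 7 _⊗_

_⊕_ : ∀ {F H} → PolyBounded F → PolyBounded H → PolyBounded (λ d → F d + H d)
(C , e , F≤) ⊕ (C′ , e′ , H≤) = C + C′ , e + e′ , λ d → ℕₚ.≤-trans (ℕₚ.+-mono-≤
    (ℕₚ.≤-trans (F≤ d) (ℕₚ.*-monoʳ-≤ C (ℕₚ.^-monoʳ-≤ (suc d) (ℕₚ.m≤m+n e e′))))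
    (ℕₚ.≤-trans (H≤ d) (ℕₚ.*-monoʳ-≤ C′ (ℕₚ.^-monoʳ-≤ (suc d) (ℕₚ.m≤n+m e′ e)))))
  (ℕₚ.≤-reflexive (sym (ℕₚ.*-distribʳ-+ (suc d ^ (e + e′)) C C′)))

_⊗_ : ∀ {F H} → PolyBounded F → PolyBounded H → PolyBounded (λ d → F d * H d)
(C , e , F≤) ⊗ (C′ , e′ , H≤) = C * C′ , e + e′ , λ d → ℕₚ.≤-trans (ℕₚ.*-mono-≤ (F≤ d) (H≤ d))
  (ℕₚ.≤-reflexive (trans (ℕₚ.[m*n]*[o*p]≡[m*o]*[n*p] C (suc d ^ e) C′ (suc d ^ e′))
    (cong (C * C′ *_) (sym (ℕₚ.^-distribˡ-+-* (suc d) e e′)))))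

poly-^ : ∀ {F} → PolyBounded F → ∀ k → PolyBounded (λ d → F d ^ k)
poly-^ F zero    = poly-const 1
poly-^ F (suc k) = F ⊗ poly-^ F k

poly-walkDensity : ∀ s {F} → PolyBounded F → PolyBounded (λ d → walkDensity s (F d) d)
poly-walkDensity s F = K₁ ⊗ (K₁ ⊗ (poly-const 1 ⊕ (poly-const s ⊗ F ⊕ poly-const s ⊗ F))) ⊗ poly-id
  where K₁ = poly-const 1 ⊕ ((F ⊕ F) ⊕ (F ⊕ F))

poly-stageBound : ∀ s t → PolyBounded (λ d → stageBound s d t)
poly-stageBound s zero    = poly-walkDensity s (poly-const 0) ⊕ poly-walkDensity s (poly-const 0)
poly-stageBound s (suc t) = M ⊕ ((poly-walkDensity s K ⊕ poly-walkDensity s K) ⊕ (K ⊕ K))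
  where
  M = poly-stageBound s t
  K = M ⊗ M ⊕ (M ⊗ M ⊕ M ⊗ M)

poly-vertexColours : ∀ s → PolyBounded (vertexColours s)
poly-vertexColours s = poly-const 1 ⊕ (D ⊕ D)
  where D = poly-^ (poly-const 1 ⊕ poly-stageBound s s) (suc s * suc s)

-- Natural numbers as rationals and the bounding polynomial

open import Data.Integer.Base using (+_)

ι : ℕ → ℚ.ℚ
ι n = + n ℚ./ 1

/-mono : ∀ a b m n → a * suc n ≤ m * suc b → + a ℚ./ suc b ℚ.≤ + m ℚ./ suc n
/-mono a b m n le = ℚₚ.toℚᵘ-cancel-≤ (ℚᵘₚ.≤-respʳ-≃ (ℚᵘₚ.≃-sym (ℚₚ.toℚᵘ-fromℚᵘ (mkℚᵘ (+ m) n)))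
  (ℚᵘₚ.≤-respˡ-≃ (ℚᵘₚ.≃-sym (ℚₚ.toℚᵘ-fromℚᵘ (mkℚᵘ (+ a) b)))
  (ℚᵘ.*≤* (subst₂ ℤ._≤_ (ℤₚ.pos-* a (suc n)) (ℤₚ.pos-* m (suc b)) (ℤ.+≤+ le)))))

/-cancel : ∀ a b m n → + a ℚ./ suc b ℚ.≤ + m ℚ./ suc n → a * suc n ≤ m * suc b
/-cancel a b m n le = ℤₚ.drop‿+≤+ (subst₂ ℤ._≤_ (sym (ℤₚ.pos-* a (suc n))) (sym (ℤₚ.pos-* m (suc b))) (ℚᵘₚ.drop-*≤*
  (ℚᵘₚ.≤-respʳ-≃ (ℚₚ.toℚᵘ-fromℚᵘ (mkℚᵘ (+ m) n)) (ℚᵘₚ.≤-respˡ-≃ (ℚₚ.toℚᵘ-fromℚᵘ (mkℚᵘ (+ a) b)) (ℚₚ.toℚᵘ-mono-≤ le)))))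

ι-+ : ∀ a b → ι (a + b) ≡ ι a ℚ.+ ι b
ι-+ a b = ℚₚ.toℚᵘ-injective (ℚᵘₚ.≃-trans (ℚₚ.toℚᵘ-fromℚᵘ (mkℚᵘ (+ (a + b)) 0)) (ℚᵘₚ.≃-trans
  (ℚᵘ.*≡* (cong (ℤ._* + 1) (trans (ℤₚ.pos-+ a b) (sym (cong₂ ℤ._+_ (ℤₚ.*-identityʳ (+ a)) (ℤₚ.*-identityʳ (+ b)))))))
  (ℚᵘₚ.≃-sym (ℚᵘₚ.≃-trans (ℚₚ.toℚᵘ-homo-+ (ι a) (ι b)) (ℚᵘₚ.+-cong (ℚₚ.toℚᵘ-fromℚᵘ (mkℚᵘ (+ a) 0)) (ℚₚ.toℚᵘ-fromℚᵘ (mkℚᵘ (+ b) 0)))))))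

ι-* : ∀ a b → ι (a * b) ≡ ι a ℚ.* ι b
ι-* a b = ℚₚ.toℚᵘ-injective (ℚᵘₚ.≃-trans (ℚₚ.toℚᵘ-fromℚᵘ (mkℚᵘ (+ (a * b)) 0)) (ℚᵘₚ.≃-trans
  (ℚᵘ.*≡* (cong (ℤ._* + 1) (ℤₚ.pos-* a b)))
  (ℚᵘₚ.≃-sym (ℚᵘₚ.≃-trans (ℚₚ.toℚᵘ-homo-* (ι a) (ι b)) (ℚᵘₚ.*-cong (ℚₚ.toℚᵘ-fromℚᵘ (mkℚᵘ (+ a) 0)) (ℚₚ.toℚᵘ-fromℚᵘ (mkℚᵘ (+ b) 0)))))))

ι-mono : ∀ {a b} → a ≤ b → ι a ℚ.≤ ι b
ι-mono {a} {b} le = /-mono a 0 b 0 (ℕₚ.*-monoˡ-≤ 1 le)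

-- The coefficients of a + (x + 2) P(x).
timesX+2 : ℚ.ℚ → Polynomial → Polynomial
timesX+2 a []      = [ a ]
timesX+2 a (b ∷ P) = (a ℚ.+ ι 2 ℚ.* b) ∷ timesX+2 b P

eval-timesX+2 : ∀ a P x → eval (timesX+2 a P) x ≡ a ℚ.+ (x ℚ.+ ι 2) ℚ.* eval P x
eval-timesX+2 a []      x = solve 3 (λ a x t → a :+ x :* con ℚ.0ℚ := a :+ (x :+ t) :* con ℚ.0ℚ) refl a x (ι 2)
  where open +-*-Solver
eval-timesX+2 a (b ∷ P) x = trans (cong (λ y → a ℚ.+ ι 2 ℚ.* b ℚ.+ x ℚ.* y) (eval-timesX+2 b P x))
  (solve 5 (λ a b x t y → a :+ t :* b :+ x :* (b :+ (x :+ t) :* y) := a :+ (x :+ t) :* (b :+ x :* y)) refl a b x (ι 2) (eval P x))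
  where open +-*-Solver

-- The coefficients of C (x + 2)ᵉ.
powerX+2 : ℕ → ℕ → Polynomial
powerX+2 C zero    = [ ι C ]
powerX+2 C (suc e) = timesX+2 ℚ.0ℚ (powerX+2 C e)

-- From `d ≤ q + 1` follows `d + 1 ≤ q + 2`, and the polynomial takes the value `C (q + 2) ^ e`;
-- `0 ≤ q` makes multiplication by `q + 2` monotone.
≤eval-powerX+2 : ∀ C e d q → ℚ.0ℚ ℚ.≤ q → ι d ℚ.≤ q ℚ.+ ι 1 → ι (C * suc d ^ e) ℚ.≤ eval (powerX+2 C e) q
≤eval-powerX+2 C zero d q 0≤q d≤ = ℚₚ.≤-reflexive (trans (cong ι (ℕₚ.*-identityʳ C)) (sym
  (trans (cong (ι C ℚ.+_) (ℚₚ.*-zeroʳ q)) (ℚₚ.+-identityʳ (ι C)))))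
≤eval-powerX+2 C (suc e) d q 0≤q d≤ = begin
  ι (C * (suc d * X))                     ≡⟨ cong ι (trans (sym (ℕₚ.*-assoc C (suc d) X)) (trans (cong (_* X) (ℕₚ.*-comm C (suc d))) (ℕₚ.*-assoc (suc d) C X))) ⟩
  ι (suc d * (C * X))                     ≡⟨ ι-* (suc d) (C * X) ⟩
  ι (suc d) ℚ.* ι (C * X)                 ≤⟨ ℚₚ.*-monoʳ-≤-nonNeg (ι (C * X)) ⦃ ℚ.nonNegative (ι-mono {0} {C * X} z≤n) ⦄ suc-d≤ ⟩
  (q ℚ.+ ι 2) ℚ.* ι (C * X)               ≤⟨ ℚₚ.*-monoˡ-≤-nonNeg (q ℚ.+ ι 2) ⦃ ℚ.nonNegative (ℚₚ.+-mono-≤ 0≤q (ι-mono {0} {2} z≤n)) ⦄ (≤eval-powerX+2 C e d q 0≤q d≤) ⟩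
  (q ℚ.+ ι 2) ℚ.* P                       ≡⟨ ℚₚ.+-identityˡ _ ⟨
  ℚ.0ℚ ℚ.+ (q ℚ.+ ι 2) ℚ.* P              ≡⟨ eval-timesX+2 ℚ.0ℚ (powerX+2 C e) q ⟨
  eval (powerX+2 C (suc e)) q             ∎
  where
  open ℚₚ.≤-Reasoning
  X = suc d ^ e
  P = eval (powerX+2 C e) q
  suc-d≤ : ι (suc d) ℚ.≤ q ℚ.+ ι 2
  suc-d≤ = subst₂ ℚ._≤_ (trans (sym (ι-+ d 1)) (cong ι (ℕₚ.+-comm d 1)))
    (trans (ℚₚ.+-assoc q (ι 1) (ι 1)) (cong (q ℚ.+_) (sym (ι-+ 1 1)))) (ℚₚ.+-monoˡ-≤ (ι 1) d≤)

-- From the maximum density to the number of colours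

ratio≥0 : ∀ m n → ℚ.0ℚ ℚ.≤ ratio m n
ratio≥0 m zero    = ℚₚ.≤-refl
ratio≥0 m (suc n) = /-mono 0 0 m n z≤n

-- For a nonzero denominator the floor plus one is taken, which need not be the least integer above
-- the ratio but stays within 1 of it.
∃-ceiling : ∀ m n → ∃ λ d → ratio m n ℚ.≤ ι d × ι d ℚ.≤ ratio m n ℚ.+ ι 1
∃-ceiling m zero    = 0 , ℚₚ.≤-refl , ι-mono {0} {1} z≤n
∃-ceiling m (suc n) = suc (m / suc n) ,
  /-mono m n (suc (m / suc n)) 0 (ℕₚ.≤-trans (ℕₚ.≤-reflexive (trans (ℕₚ.*-identityʳ m) (m≡m%n+[m/n]*n m (suc n))))
    (ℕₚ.+-monoˡ-≤ (m / suc n * suc n) (ℕₚ.<⇒≤ (m%n<n m (suc n))))) ,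
  subst (ℚ._≤ ratio m (suc n) ℚ.+ ι 1) (trans (sym (ι-+ (m / suc n) 1)) (cong ι (ℕₚ.+-comm (m / suc n) 1)))
    (ℚₚ.+-monoˡ-≤ (ι 1) (/-mono (m / suc n) 0 m n (ℕₚ.≤-trans (m/n*n≤m m (suc n)) (ℕₚ.≤-reflexive (sym (ℕₚ.*-identityʳ m))))))

-- Stated for an adjacency function so that the number of vertices can be split on; on no vertices
-- the edge list is empty by computation.
ratio≤⇒size≤ : ∀ d {n} (adj : Fin n → Fin n → Bool) → ratio (length (edgeList adj)) n ℚ.≤ ι d → length (edgeList adj) ≤ d * n
ratio≤⇒size≤ d {zero}  adj le = z≤n
ratio≤⇒size≤ d {suc n} adj le = ℕₚ.≤-trans (ℕₚ.≤-reflexive (sym (ℕₚ.*-identityʳ _))) (/-cancel (length (edgeList adj)) n d 0 le)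

N≤ : ∀ r G d → (∀ H → ShallowTopMinor (2 * 2 ^ r) H G → size H ≤ d * Graph.order H) →
     N f₀ f₀≤id G r ≤ vertexColours (2 * 2 ^ r) d * vertexColours (2 * 2 ^ r) d
N≤ r G d sparse = let (c , rooted) = ∃-rootedColouring G (2 * 2 ^ r) d sparse in
  proj₂ (proj₂ (minColours f₀ f₀≤id G r)) _
    -- `2 * 2 ^ r` is `2 ^ suc r` by definition, and the colouring is rooted for
    -- `ℓ = 1 + 2 * 2 ^ r`.
    (EdgeColouring.colouring G c rooted , EdgeColouring.colouring-good G c rooted r (ℕₚ.≤-trans (ℕₚ.n≤1+n _) (ℕₚ.n≤1+n _)))

-- The bound goes through an integer `d` between the maximum density and that density plus 1. The
-- maximising `H` is used to write the density as a ratio, from which `d` is computed.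
N≤eval-powerX+2 : ∀ r C e → (∀ d → vertexColours (2 * 2 ^ r) d * vertexColours (2 * 2 ^ r) d ≤ C * suc d ^ e) →
                  ∀ G → ι (N f₀ f₀≤id G r) ℚ.≤ eval (powerX+2 C e) (∇̃ (2 * 2 ^ r) G)
N≤eval-powerX+2 r C e colours≤ G with proj₂ (maxDensity (2 * 2 ^ r) G)
... | (H , _ , density≡) , max with ∃-ceiling (size H) (Graph.order H)
...   | d , ≤d , d≤ = ℚₚ.≤-trans (ι-mono (ℕₚ.≤-trans (N≤ r G d sparse) (colours≤ d)))
    (≤eval-powerX+2 C e d (∇̃ (2 * 2 ^ r) G) (subst (ℚ.0ℚ ℚ.≤_) density≡ (ratio≥0 (size H) (Graph.order H)))
      (subst (λ q → ι d ℚ.≤ q ℚ.+ ι 1) density≡ d≤))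
  where
  sparse : ∀ H′ → ShallowTopMinor (2 * 2 ^ r) H′ G → size H′ ≤ d * Graph.order H′
  sparse H′ minor = ratio≤⇒size≤ d (Graph.adj H′) (ℚₚ.≤-trans (max H′ minor) (subst (ℚ._≤ ι d) density≡ ≤d))

mainTheorem5 : ∀ (r : ℕ) → 1 ≤ r →
    ∃ λ (P : Polynomial) → ∀ (G : Graph) →
    (+ N f₀ f₀≤id G r) ℚ./ 1 ℚ.≤ eval P (∇̃ (2 * 2 ^ r) G)
mainTheorem5 r _ = let (C , e , colours≤) = poly-vertexColours (2 * 2 ^ r) ⊗ poly-vertexColours (2 * 2 ^ r) in
  powerX+2 C e , N≤eval-powerX+2 r C e colours≤
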